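{- If $G$ is a König–Egerváry graph, then: (i) there are no $\mu$-critical edges of $G$ in $(\ker(G),N(\ker(G)))$; (ii) there are no $\mu$-critical edges of $G$ in $(\mathrm{core}(G)-\ker(G),N(\ker(G)))$; (iii) the only possible location for $\mu$-critical edges of $G$ in $(\mathrm{core}(G),N(\mathrm{core}(G)))$ is $(\mathrm{core}(G)-\ker(G),\,N(\mathrm{core}(G))-N(\ker(G)))$; (iv) the maximum possible number of $\mu$-critical edges of $G$ in $(\mathrm{core}(G),N(\mathrm{core}(G)))$ is equal to $\xi(G)-\varepsilon(G)$; (v) $\varrho_e(G)\geq m(G)-\xi(G)+\varepsilon(G)$.
   Context: All graphs are finite, undirected, without loops or multiple edges; $n(G)=|V(G)|$, $m(G)=|E(G)|$. $\alpha(G)$ is the maximum size of an independent set of $G$ and $\mu(G)$ is the maximum size of a matching of $G$. $G$ is a König–Egerváry graph if $\alpha(G)+\mu(G)=n(G)$. For $A\subseteq V(G)$, $N(A)$ is the set of vertices having at least one neighbor in $A$. For disjoint $A,B\subseteq V(G)$, $(A,B)$ denotes the set of edges $ab\in E(G)$ with $a\in A$, $b\in B$. $d(G)=\max\{|A|-|N(A)|:A\subseteq V(G)\}$ is the critical difference (the maximum is also attained over independent sets), and an independent set $A$ (possibly empty) is a critical independent set if $|A|-|N(A)|=d(G)$. $\ker(G)$ is the intersection of all critical independent sets of $G$, and $\varepsilon(G)=|\ker(G)|$. $\mathrm{core}(G)$ is the intersection of all maximum independent sets of $G$, and $\xi(G)=|\mathrm{core}(G)|$; one always has $\ker(G)\subseteq\mathrm{core}(G)$.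 An edge $e$ is $\mu$-critical if $\mu(G-e)<\mu(G)$, where $G-e$ is obtained by deleting the edge $e$ (keeping all vertices). $\varrho_e(G)$ is the number of edges $e\in E(G)$ such that $G-e$ is a König–Egerváry graph. -}

module Defs where

open import Data.Bool.Base using (true; false)
open import Data.Fin.Base using (Fin; _<_)
open import Data.Fin.Properties using (all?; any?; _≟_; _<?_)
open import Data.Fin.Subset using (Subset; inside; outside; _∈_; ∣_∣; ⋂)
open import Data.Fin.Subset.Properties using (_∈?_)
open import Data.Integer.Base as ℤ using (ℤ; +_)
import Data.Integer.Properties as ℤ
open import Data.List.Base using (List; []; _∷_; _++_; map; filter; length; allFin; cartesianProduct)
import Data.List.Extrema
import Data.List.Extrema.Nat as ℕ-Extrema
import Data.List.Membership.Propositional as List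
open import Data.List.Membership.Propositional.Properties using (∈-++⁺ˡ; ∈-++⁺ʳ; ∈-++⁻; ∈-map⁺; ∈-map⁻)
open import Data.List.Relation.Binary.Sublist.Propositional using (_⊆_; []; _∷_; _∷ʳ_)
open import Data.List.Relation.Unary.AllPairs using (AllPairs; allPairs?)
open import Data.List.Relation.Unary.Any using (here)
open import Data.Nat.Base as ℕ using (ℕ; zero; suc)
import Data.Nat.Properties as ℕ
open import Data.Product.Base using (_×_; _,_)
open import Data.Product.Properties using (≡-dec)
open import Data.Sum.Base using (_⊎_; inj₁; inj₂)
open import Data.Vec.Base using ([]; _∷_; tabulate)
open import Level using (0ℓ)
open import Relation.Binary.Core using (Rel)
open import Relation.Binary.Definitions using (Symmetric; Irreflexive; Decidable)
open import Relation.Binary.PropositionalEquality using (_≡_; _≢_; refl)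
open import Relation.Nullary using (¬_; Dec; does; ¬?)
open import Relation.Nullary.Decidable using (_×-dec_; _⊎-dec_; _→-dec_)
open import Relation.Unary as U using (Pred)

private
  variable
    n : ℕ
    A : Set

------------------------------------------------------------------------
-- Enumerating finite sets

subsets : ∀ n → List (Subset n)
subsets zero    = [] ∷ []
subsets (suc n) = map (inside ∷_) (subsets n) ++ map (outside ∷_) (subsets n)

∈-subsets : (p : Subset n) → p List.∈ subsets n
∈-subsets []          = here refl
∈-subsets (true ∷ p)  = ∈-++⁺ˡ (∈-map⁺ (inside ∷_) (∈-subsets p))
∈-subsets (false ∷ p) = ∈-++⁺ʳ _ (∈-map⁺ (outside ∷_) (∈-subsets p))

sublists : List A → List (List A)
sublists []       = [] ∷ []
sublists (x ∷ xs) = map (x ∷_) (sublists xs) ++ sublists xs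

∈-sublists⁺ : {xs ys : List A} → xs ⊆ ys → xs List.∈ sublists ys
∈-sublists⁺ []         = here refl
∈-sublists⁺ (y ∷ʳ p)   = ∈-++⁺ʳ _ (∈-sublists⁺ p)
∈-sublists⁺ (refl ∷ p) = ∈-++⁺ˡ (∈-map⁺ _ (∈-sublists⁺ p))

∈-sublists⁻ : {xs : List A} (ys : List A) → xs List.∈ sublists ys → xs ⊆ ys
∈-sublists⁻ []       (here refl) = []
∈-sublists⁻ (y ∷ ys) p with ∈-++⁻ (map (y ∷_) (sublists ys)) p
... | inj₂ q = y ∷ʳ ∈-sublists⁻ ys q
... | inj₁ q with ∈-map⁻ (y ∷_) q
...   | _ , r , refl = refl ∷ ∈-sublists⁻ ys r

------------------------------------------------------------------------
-- Graphs

record Graph (n : ℕ) : Set₁ where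
  field
    _~_    : Rel (Fin n) 0ℓ
    ~-sym  : Symmetric _~_
    ~-irr  : Irreflexive _≡_ _~_
    _~?_   : Decidable _~_

-- The unordered edge {u , v} is represented by the pair (u , v) with u < v.
Edge : ℕ → Set
Edge n = Fin n × Fin n

module _ (G : Graph n) where
  open Graph G

  IsEdge : Pred (Edge n) 0ℓ
  IsEdge (u , v) = u < v × u ~ v

  isEdge? : U.Decidable IsEdge
  isEdge? (u , v) = (u <? v) ×-dec (u ~? v)

  edges : List (Edge n)
  edges = filter isEdge? (cartesianProduct (allFin n) (allFin n))

  m : ℕ
  m = length edges

_≟ᵉ_ : (e f : Edge n) → Dec (e ≡ f)
_≟ᵉ_ = ≡-dec _≟_ _≟_

infixl 6 _-ₑ_

_-ₑ_ : Graph n → Edge n → Graph n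
G -ₑ e = record
  { _~_   = λ u v → u ~ v × (u , v) ≢ e × (v , u) ≢ e
  ; ~-sym = λ (a , p , q) → ~-sym a , q , p
  ; ~-irr = λ eq (a , _) → ~-irr eq a
  ; _~?_  = λ u v → (u ~? v) ×-dec (¬? ((u , v) ≟ᵉ e) ×-dec ¬? ((v , u) ≟ᵉ e))
  }
  where open Graph G

------------------------------------------------------------------------
-- Neighbourhoods and the edge sets (A , B)

module _ (G : Graph n) where
  open Graph G

  N : Subset n → Subset n
  N A = tabulate λ v → does (any? λ u → (u ∈? A) ×-dec (u ~? v))

Joins : Subset n → Subset n → Pred (Edge n) 0ℓ
Joins A B (u , v) = (u ∈ A × v ∈ B) ⊎ (v ∈ A × u ∈ B)

joins? : (A B : Subset n) → U.Decidable (Joins A B)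
joins? A B (u , v) = ((u ∈? A) ×-dec (v ∈? B)) ⊎-dec ((v ∈? A) ×-dec (u ∈? B))

edgesBetween : Graph n → Subset n → Subset n → List (Edge n)
edgesBetween G A B = filter (joins? A B) (edges G)

------------------------------------------------------------------------
-- Independent sets and matchings

module _ (G : Graph n) where
  open Graph G

  Independent : Pred (Subset n) 0ℓ
  Independent A = ∀ u v → u ∈ A → v ∈ A → ¬ (u ~ v)

  independent? : U.Decidable Independent
  independent? A = all? λ u → all? λ v →
    (u ∈? A) →-dec ((v ∈? A) →-dec ¬? (u ~? v))

  -- The default value 0 is the size of the empty independent set.
  α : ℕ
  α = ℕ-Extrema.max 0 (map ∣_∣ (filter independent? (subsets n)))

NonIncident : Rel (Edge n) 0ℓ
NonIncident (u , v) (x , y) = (u ≢ x × u ≢ y) × (v ≢ x × v ≢ y)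

nonIncident? : Decidable (NonIncident {n})
nonIncident? (u , v) (x , y) =
  (¬? (u ≟ x) ×-dec ¬? (u ≟ y)) ×-dec (¬? (v ≟ x) ×-dec ¬? (v ≟ y))

-- `edges G` has no repetitions, so its sublists are exactly the sets of
-- edges of G; a matching is such a set of pairwise non-incident edges.
matchings : Graph n → List (List (Edge n))
matchings G = filter (allPairs? nonIncident?) (sublists (edges G))

-- The default value 0 is the size of the empty matching.
μ : Graph n → ℕ
μ G = ℕ-Extrema.max 0 (map length (matchings G))

KonigEgervary : ∀ {n} → Graph n → Set
KonigEgervary {n} G = α G ℕ.+ μ G ≡ n

konigEgervary? : (G : Graph n) → Dec (KonigEgervary G)
konigEgervary? G = _ ℕ.≟ _

MuCritical : Graph n → Pred (Edge n) 0ℓ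
MuCritical G e = μ (G -ₑ e) ℕ.< μ G

muCritical? : (G : Graph n) → U.Decidable (MuCritical G)
muCritical? G e = _ ℕ.<? _

------------------------------------------------------------------------
-- core, ker and the numerical invariants

module _ (G : Graph n) where

  MaximumIndependent : Pred (Subset n) 0ℓ
  MaximumIndependent A = Independent G A × ∣ A ∣ ≡ α G

  maximumIndependent? : U.Decidable MaximumIndependent
  maximumIndependent? A = independent? G A ×-dec (_ ℕ.≟ _)

  difference : Subset n → ℤ
  difference A = + ∣ A ∣ ℤ.- + ∣ N G A ∣

  -- The default value 0 is the difference of the empty set.
  d : ℤ
  d = Data.List.Extrema.max ℤ.≤-totalOrder (+ 0) (map difference (subsets n))

  CriticalIndependent : Pred (Subset n) 0ℓ
  CriticalIndependent A = Independent G A × difference A ≡ d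

  criticalIndependent? : U.Decidable CriticalIndependent
  criticalIndependent? A = independent? G A ×-dec (_ ℤ.≟ _)

  core : Subset n
  core = ⋂ (filter maximumIndependent? (subsets n))

  ker : Subset n
  ker = ⋂ (filter criticalIndependent? (subsets n))

  ξ : ℕ
  ξ = ∣ core ∣

  ε : ℕ
  ε = ∣ ker ∣

  -- The number of μ-critical edges in (core G , N (core G)).
  coreCriticalCount : ℕ
  coreCriticalCount = length (filter (muCritical? G) (edgesBetween G core (N G core)))

  ϱₑ : ℕ
  ϱₑ = length (filter (λ e → konigEgervary? (G -ₑ e)) (edges G))

{-# OPTIONS --safe #-}
module Submission where

open import Defs
open import Data.Fin.Subset using (_─_)
open import Data.Integer.Base using (+_; _+_; _-_; _≤_; _≥_)
open import Data.List.Membership.Propositional using (_∈_)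
open import Data.Nat.Base using (ℕ)
open import Data.Product.Base using (Σ; _×_)
open import Relation.Binary.PropositionalEquality using (_≡_)
open import Relation.Nullary using (¬_)

open import Data.Bool.Base using (true; false)
open import Data.Empty using (⊥)
open import Data.Fin.Base as Fin using (Fin; zero; suc)
import Data.Fin.Properties as Fin
open import Data.Fin.Properties using (_≟_; any?)
open import Data.Fin.Subset as Subset using (Subset; ∣_∣; ∁; ⋂) renaming (_∈_ to _∈ˢ_; _∉_ to _∉ˢ_)
open import Data.Fin.Subset.Properties as Subset using (_∈?_)
import Data.Integer.Base as ℤ
import Data.Integer.Properties as ℤ
open import Data.Integer.Tactic.RingSolver using (solve-∀)
open import Data.List.Base using (List; []; _∷_; _++_; map; filter; length; allFin; cartesianProduct)
import Data.List.Extrema as Extrema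
import Data.List.Extrema.Nat as ℕ-Extrema
open import Data.List.Membership.Propositional using (_∉_)
open import Data.List.Membership.Propositional.Properties using (∈-++⁺ˡ; ∈-++⁺ʳ; ∈-++⁻; ∈-map⁺; ∈-map⁻; ∈-∃++; ∈-filter⁺; ∈-filter⁻; ∈-allFin; ∈-cartesianProduct⁺)
import Data.List.Membership.DecPropositional as DecMembership
open import Data.List.Properties using (length-++; length-map; length-tabulate)
open import Data.List.Relation.Binary.Permutation.Propositional using (_↭_)
open import Data.List.Relation.Binary.Permutation.Propositional.Properties using (shift; ↭-length; ∈-resp-↭)
import Data.List.Relation.Binary.Sublist.Propositional as Sublist
import Data.List.Relation.Binary.Sublist.Propositional.Properties as Sublist
open import Data.List.Relation.Unary.All as All using (All; []; _∷_)
open import Data.List.Relation.Unary.AllPairs as AllPairs using (AllPairs; []; _∷_)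
open import Data.List.Relation.Unary.Any using (here; there)
open import Data.List.Relation.Unary.Unique.Propositional using (Unique)
import Data.List.Relation.Unary.Unique.Propositional.Properties as Unique
import Data.Nat.Base as ℕ
import Data.Nat.Properties as ℕ
open import Data.Product.Base using (_,_; proj₁; proj₂; ∃; ∃₂)
open import Data.Sum.Base as Sum using (_⊎_; inj₁; inj₂)
open import Data.Sum.Function.Propositional using (_⊎-↔_)
open import Data.Sum.Properties using (inj₁-injective; inj₂-injective)
open import Data.Unit.Base using (⊤; tt)
open import Data.Vec.Base using ([]; _∷_; here; there; tabulate)
open import Data.Vec.Functional using (updateAt)
open import Data.Vec.Functional.Properties using (updateAt-updates; updateAt-minimal)
import Data.Vec.Properties as Vec
open import Function.Base using (_∘_; id; case_of_)
open import Function.Bundles using (_↔_; Inverse)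
open import Function.Properties.Inverse using (↔-trans)
open import Relation.Binary.Definitions using (tri<; tri≈; tri>)
open import Relation.Binary.PropositionalEquality using (_≢_; refl; sym; trans; cong; cong₂; subst; subst₂)
open import Relation.Nullary using (Dec; yes; no; does; contradiction)
open import Relation.Nullary.Decidable using (_×-dec_; _⊎-dec_; ¬?; map′; dec-true; decidable-stable)
import Relation.Unary as U

-- In a König–Egerváry graph a maximum matching saturates the complement of every maximum
-- independent set S by an injection g into S, and d(G) = |S| - |V ∖ S|.  Let b g(b) be an edge that
-- every maximum matching uses, b ∉ S, and grow an alternating tree from b: a set T outside S such
-- that every neighbour in S of a t ∈ T is g(t′) for some t′ ∈ T.  Growing never gets stuck, since
-- an alternative for g(b) would give a maximum matching avoiding that edge.
-- Then S ∖ g(T) is a critical independent set without neighbours of b, so no neighbour of b lies in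
-- ker(G); this gives (i)-(iii), and (iv) because g maps the critical edges injectively to core(G).
-- If another maximum independent set S′ contains b, then T ⊆ S′ and T ∪ (S ∖ g(T ∖ b)) is independent
-- after deleting the edge b g(b), which remains König–Egerváry; hence the only exceptions in (v) are
-- the critical edges at core(G).

-- Criticality of an edge e enters the tree argument in one form only. Since μ(G) = |V ∖ S|, an
-- injection that saturates the complement of S along edges of G - e shows μ(G - e) ≥ μ(G), so a
-- μ-critical edge belongs to every saturating injection. Alternating paths are not represented.
-- Each vertex t of the tree carries instead a rerouted injection that leaves only t unmatched and
-- never takes the value g(b); handing t a vertex outside the range of that injection completes it
-- to a saturating one. The tree is grown relative to a property P that passes from vertex to
-- vertex. The trivial P serves the kernel, and membership in S′ serves the deletion of an edge, so
-- one construction covers both uses. As (iv) asserts a maximum, the bound has to be met for every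
-- pair ε ≤ ξ that occurs; an explicit family of graphs with two free parameters does this.

private
  variable
    A B : Set
    n : ℕ

module _ {n : ℕ} where
  open DecMembership (_≟_ {n}) public using () renaming (_∈?_ to _∈ᴸ?_)

-- Counting

remove : {y : B} {ys : List B} → y ∈ ys → ∃ λ zs → ys ↭ y ∷ zs
remove y∈ys with l , r , refl ← ∈-∃++ y∈ys = l ++ r , shift _ l r

module _ (R : A → B → Set) where

  -- Injections are given as relations, which need not be functional: totality and left uniqueness
  -- suffice for counting. The case distinctions that choose an image then occur only in the proof
  -- of totality.
  Total : List A → List B → Set
  Total xs ys = ∀ {x} → x ∈ xs → ∃ λ y → y ∈ ys × R x y

  LeftUnique : List A → Set
  LeftUnique xs = ∀ {x x′ y} → x ∈ xs → x′ ∈ xs → R x y → R x′ y → x ≡ x′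

  private
    total-tail : ∀ {x y xs ys zs} → All (x ≢_) xs → ys ↭ y ∷ zs → R x y →
                 Total (x ∷ xs) ys → LeftUnique (x ∷ xs) → Total xs zs
    total-tail x≢ p r tot uni x′∈ with tot (there x′∈)
    ... | y′ , y′∈ , r′ with ∈-resp-↭ p y′∈
    ...   | here refl  = contradiction (uni (here refl) (there x′∈) r r′) (All.lookup x≢ x′∈)
    ...   | there y′∈′ = y′ , y′∈′ , r′

  length-≤ : ∀ {xs ys} → Unique xs → Total xs ys → LeftUnique xs → length xs ℕ.≤ length ys
  length-≤ [] _ _ = ℕ.z≤n
  length-≤ (x≢ ∷ u) tot uni with tot (here refl)
  ... | y , y∈ , r with remove y∈
  ...   | zs , p = subst (_ ℕ.≤_) (sym (↭-length p))
                     (ℕ.s≤s (length-≤ u (total-tail x≢ p r tot uni) λ a b → uni (there a) (there b)))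

  -- An injection into a set that is no larger is onto.
  covered : ∀ {xs ys} → Unique xs → Total xs ys → LeftUnique xs →
            length ys ℕ.≤ length xs → ∀ {z} → z ∈ ys → ∃ λ x → x ∈ xs × R x z
  covered {ys = _ ∷ _} [] _ _ () _
  covered (x≢ ∷ u) tot uni ys≤ z∈ with tot (here refl)
  ... | y , y∈ , r with remove y∈
  ...   | zs , p with ∈-resp-↭ p z∈
  ...     | here refl = _ , here refl , r
  ...     | there z∈′ with covered u (total-tail x≢ p r tot uni) (λ a b → uni (there a) (there b))
                             (ℕ.≤-pred (subst (ℕ._≤ _) (↭-length p) ys≤)) z∈′
  ...       | x , x∈ , r′ = x , there x∈ , r′

infixr 5 _⊕_

-- The tags make lengths add up without any disjointness condition, so an inequality between sums of
-- cardinalities becomes a single injection.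
_⊕_ : List A → List B → List (A ⊎ B)
xs ⊕ ys = map inj₁ xs ++ map inj₂ ys

module _ {xs : List A} {ys : List B} where

  length-⊕ : length (xs ⊕ ys) ≡ length xs ℕ.+ length ys
  length-⊕ = trans (length-++ (map inj₁ xs)) (cong₂ ℕ._+_ (length-map inj₁ xs) (length-map inj₂ ys))

  ∈-⊕⁺ˡ : ∀ {x} → x ∈ xs → inj₁ x ∈ xs ⊕ ys
  ∈-⊕⁺ˡ = ∈-++⁺ˡ ∘ ∈-map⁺ inj₁

  ∈-⊕⁺ʳ : ∀ {y} → y ∈ ys → inj₂ y ∈ xs ⊕ ys
  ∈-⊕⁺ʳ = ∈-++⁺ʳ _ ∘ ∈-map⁺ inj₂

  ∈-⊕⁻ˡ : ∀ {x} → inj₁ x ∈ xs ⊕ ys → x ∈ xs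
  ∈-⊕⁻ˡ p with ∈-++⁻ (map inj₁ xs) p
  ... | inj₁ q with _ , x∈ , refl ← ∈-map⁻ inj₁ q = x∈
  ... | inj₂ q with _ , _ , () ← ∈-map⁻ inj₂ q

  ∈-⊕⁻ʳ : ∀ {y} → inj₂ y ∈ xs ⊕ ys → y ∈ ys
  ∈-⊕⁻ʳ p with ∈-++⁻ (map inj₁ xs) p
  ... | inj₂ q with _ , y∈ , refl ← ∈-map⁻ inj₂ q = y∈
  ... | inj₁ q with _ , _ , () ← ∈-map⁻ inj₁ q

  unique-⊕ : Unique xs → Unique ys → Unique (xs ⊕ ys)
  unique-⊕ uˣ uʸ = Unique.++⁺ (Unique.map⁺ inj₁-injective uˣ) (Unique.map⁺ inj₂-injective uʸ) disjoint
    where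
    disjoint : ∀ {z} → ¬ (z ∈ map inj₁ xs × z ∈ map inj₂ ys)
    disjoint (p , q) with _ , _ , refl ← ∈-map⁻ inj₁ p | _ , _ , () ← ∈-map⁻ inj₂ q

elements : Subset n → List (Fin n)
elements []          = []
elements (true ∷ p)  = zero ∷ map suc (elements p)
elements (false ∷ p) = map suc (elements p)

length-elements : (p : Subset n) → length (elements p) ≡ ∣ p ∣
length-elements []          = refl
length-elements (true ∷ p)  = cong ℕ.suc (trans (length-map suc (elements p)) (length-elements p))
length-elements (false ∷ p) = trans (length-map suc (elements p)) (length-elements p)

∈-elements⁺ : ∀ {p : Subset n} {v} → v ∈ˢ p → v ∈ elements p
∈-elements⁺ here                    = here refl
∈-elements⁺ {p = true ∷ _}  (there q) = there (∈-map⁺ suc (∈-elements⁺ q))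
∈-elements⁺ {p = false ∷ _} (there q) = ∈-map⁺ suc (∈-elements⁺ q)

∈-elements⁻ : ∀ (p : Subset n) {v} → v ∈ elements p → v ∈ˢ p
∈-elements⁻ (true ∷ p)  (here refl) = here
∈-elements⁻ (true ∷ p)  (there q) with _ , r , refl ← ∈-map⁻ suc q = there (∈-elements⁻ p r)
∈-elements⁻ (false ∷ p) q with _ , r , refl ← ∈-map⁻ suc q = there (∈-elements⁻ p r)

unique-elements : (p : Subset n) → Unique (elements p)
unique-elements []          = []
unique-elements (false ∷ p) = Unique.map⁺ Fin.suc-injective (unique-elements p)
unique-elements (true ∷ p)  = All.tabulate zero≢ ∷ Unique.map⁺ Fin.suc-injective (unique-elements p)
  where
  zero≢ : ∀ {v} → v ∈ map suc (elements p) → zero ≢ v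
  zero≢ q refl with _ , _ , () ← ∈-map⁻ suc q

cardinality : ∀ {p : Subset n} {xs : List A} → Unique xs → (f : A → Fin n) → (∀ {x y} → f x ≡ f y → x ≡ y) →
              (∀ {x} → x ∈ xs → f x ∈ˢ p) → (∀ {v} → v ∈ˢ p → ∃ λ x → x ∈ xs × v ≡ f x) → ∣ p ∣ ≡ length xs
cardinality {p = p} {xs} unique f f-inj into onto = trans (sym (length-elements p)) (ℕ.≤-antisym
  (length-≤ (λ v x → v ≡ f x) (unique-elements p) (onto ∘ ∈-elements⁻ p) λ _ _ eq eq′ → trans eq (sym eq′))
  (length-≤ (λ x v → f x ≡ v) unique (λ {x} x∈ → f x , ∈-elements⁺ (into x∈) , refl)
    λ _ _ eq eq′ → f-inj (trans eq (sym eq′))))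

∣p∣+∣∁p∣≡n : (p : Subset n) → ∣ p ∣ ℕ.+ ∣ ∁ p ∣ ≡ n
∣p∣+∣∁p∣≡n p = trans (cong (∣ p ∣ ℕ.+_) (Subset.∣∁p∣≡n∸∣p∣ p)) (ℕ.m+[n∸m]≡n (Subset.∣p∣≤n p))

module _ {P : Fin n → Set} (P? : U.Decidable P) where

  ∈-tabulate⁺ : ∀ {v} → P v → v ∈ˢ tabulate (does ∘ P?)
  ∈-tabulate⁺ {v} p = Vec.lookup⇒[]= v _ (trans (Vec.lookup∘tabulate (does ∘ P?) v) (dec-true (P? v) p))

  ∈-tabulate⁻ : ∀ {v} → v ∈ˢ tabulate (does ∘ P?) → P v
  ∈-tabulate⁻ {v} q with P? v | trans (sym (Vec.lookup∘tabulate (does ∘ P?) v)) (Vec.[]=⇒lookup q)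
  ... | yes p | _ = p

∈-⋂⁺ : ∀ {v : Fin n} {ps} → (∀ {p} → p ∈ ps → v ∈ˢ p) → v ∈ˢ ⋂ ps
∈-⋂⁺ {ps = []}     _ = Subset.∈⊤
∈-⋂⁺ {ps = p ∷ ps} f = Subset.x∈p∩q⁺ (f (here refl) , ∈-⋂⁺ (f ∘ there))

∈-⋂⁻ : ∀ {v : Fin n} {p ps} → p ∈ ps → v ∈ˢ ⋂ ps → v ∈ˢ p
∈-⋂⁻ {ps = q ∷ ps} (here refl) v∈ = proj₁ (Subset.x∈p∩q⁻ q (⋂ ps) v∈)
∈-⋂⁻ {ps = q ∷ ps} (there p∈)  v∈ = ∈-⋂⁻ p∈ (proj₂ (Subset.x∈p∩q⁻ q (⋂ ps) v∈))

module _ (f : A → ℕ) {P : A → Set} (P? : U.Decidable P) (xs : List A) where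

  private
    values : List ℕ
    values = map f (filter P? xs)

  ≤-max : ∀ {x} → x ∈ xs → P x → f x ℕ.≤ ℕ-Extrema.max 0 values
  ≤-max x∈ p = All.lookup (ℕ-Extrema.xs≤max 0 values) (∈-map⁺ f (∈-filter⁺ P? x∈ p))

  max-attained : ∀ {x} → x ∈ xs → P x → f x ≡ 0 → ∃ λ y → y ∈ xs × P y × f y ≡ ℕ-Extrema.max 0 values
  max-attained {x} x∈ p fx≡0 with ℕ-Extrema.argmax-sel id 0 values
  ... | inj₁ eq = x , x∈ , p , trans fx≡0 (sym eq)
  ... | inj₂ q with y , y∈ , eq ← ∈-map⁻ f q with y∈xs , py ← ∈-filter⁻ P? {xs = xs} y∈ = y , y∈xs , py , sym eq

allPairs-lookup : ∀ {R : A → A → Set} {xs} → (∀ {x y} → R x y → R y x) →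
                  AllPairs R xs → ∀ {x y} → x ∈ xs → y ∈ xs → x ≡ y ⊎ R x y
allPairs-lookup s (r ∷ rs) (here refl) (here refl) = inj₁ refl
allPairs-lookup s (r ∷ rs) (here refl) (there q)   = inj₂ (All.lookup r q)
allPairs-lookup s (r ∷ rs) (there p)   (here refl) = inj₂ (s (All.lookup r p))
allPairs-lookup s (r ∷ rs) (there p)   (there q)   = allPairs-lookup s rs p q

unique⇒allPairs : ∀ {R : A → A → Set} {xs} → Unique xs →
                  (∀ {x y} → x ∈ xs → y ∈ xs → x ≢ y → R x y) → AllPairs R xs
unique⇒allPairs []       f = []
unique⇒allPairs (x≢ ∷ u) f =
  All.tabulate (λ y∈ → f (here refl) (there y∈) (All.lookup x≢ y∈)) ∷
  unique⇒allPairs u λ p q → f (there p) (there q)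

-- Edges are stored as increasing pairs; this relation forgets the order, so that the ends can be
-- named by their role.
Links : Edge n → Fin n → Fin n → Set
Links e u v = e ≡ (u , v) ⊎ e ≡ (v , u)

links? : (e : Edge n) (u v : Fin n) → Dec (Links e u v)
links? e u v = (e ≟ᵉ (u , v)) ⊎-dec (e ≟ᵉ (v , u))

links-sym : ∀ {e : Edge n} {u v} → Links e u v → Links e v u
links-sym = Sum.swap

links-ends : ∀ {e : Edge n} {u v x y} → Links e u v → Links e x y → (x ≡ u × y ≡ v) ⊎ (x ≡ v × y ≡ u)
links-ends (inj₁ refl) (inj₁ refl) = inj₁ (refl , refl)
links-ends (inj₁ refl) (inj₂ refl) = inj₂ (refl , refl)
links-ends (inj₂ refl) (inj₁ refl) = inj₂ (refl , refl)
links-ends (inj₂ refl) (inj₂ refl) = inj₁ (refl , refl)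

links-cancelʳ : ∀ {e : Edge n} {u v w} → Links e u w → Links e v w → u ≡ v
links-cancelʳ l l′ with links-ends l l′
... | inj₁ (v≡u , _)  = sym v≡u
... | inj₂ (refl , refl) = refl

nonIncident-sym : {e f : Edge n} → NonIncident e f → NonIncident f e
nonIncident-sym ((a , b) , (c , d)) = (a ∘ sym , c ∘ sym) , (b ∘ sym , d ∘ sym)

links⇒incident : ∀ {e f : Edge n} {u v w} → Links e u v → Links f u w → ¬ NonIncident e f
links⇒incident (inj₁ refl) (inj₁ refl) ((a , _) , _) = a refl
links⇒incident (inj₁ refl) (inj₂ refl) ((_ , a) , _) = a refl
links⇒incident (inj₂ refl) (inj₁ refl) (_ , (a , _)) = a refl
links⇒incident (inj₂ refl) (inj₂ refl) (_ , (_ , a)) = a refl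

incident⇒links : ∀ {e f : Edge n} → ¬ NonIncident e f →
                 ∃ λ u → ∃₂ λ v w → Links e u v × Links f u w
incident⇒links {e = u , v} {x , y} inc with u ≟ x | u ≟ y | v ≟ x | v ≟ y
... | yes refl | _        | _        | _        = u , v , y , inj₁ refl , inj₁ refl
... | no _     | yes refl | _        | _        = u , v , x , inj₁ refl , inj₂ refl
... | no _     | no _     | yes refl | _        = v , u , y , inj₂ refl , inj₁ refl
... | no _     | no _     | no _     | yes refl = v , u , x , inj₂ refl , inj₂ refl
... | no a     | no b     | no c     | no d     = contradiction ((a , b) , (c , d)) inc

-- Edges, independent sets and matchings

-- A matching of the complement of `S` into `S`, encoded as a function of which only the values
-- outside `S` carry meaning.
record Saturates (G : Graph n) (S : Subset n) (g : Fin n → Fin n) : Set where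
  open Graph G
  field
    to-∈   : ∀ {v} → v ∉ˢ S → g v ∈ˢ S
    to-adj : ∀ {v} → v ∉ˢ S → v ~ g v
    to-inj : ∀ {v w} → v ∉ˢ S → w ∉ˢ S → g v ≡ g w → v ≡ w

open Saturates

module _ (G : Graph n) where
  open Graph G

  ∈-edges⁻ : ∀ {e} → e ∈ edges G → IsEdge G e
  ∈-edges⁻ e∈ = proj₂ (∈-filter⁻ (isEdge? G) {xs = cartesianProduct (allFin n) (allFin n)} e∈)

  ∈-edges⁺ : ∀ {e} → IsEdge G e → e ∈ edges G
  ∈-edges⁺ = ∈-filter⁺ (isEdge? G) (∈-cartesianProduct⁺ (∈-allFin _) (∈-allFin _))

  unique-edges : Unique (edges G)
  unique-edges = Unique.filter⁺ (isEdge? G) (Unique.cartesianProduct⁺ (Unique.allFin⁺ _) (Unique.allFin⁺ _))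

  ~⇒link : ∀ {u v} → u ~ v → ∃ λ e → e ∈ edges G × Links e u v
  ~⇒link {u} {v} u~v with Fin.<-cmp u v
  ... | tri< u<v _ _ = (u , v) , ∈-edges⁺ (u<v , u~v) , inj₁ refl
  ... | tri≈ _ u≡v _ = contradiction u~v (~-irr u≡v)
  ... | tri> _ _ v<u = (v , u) , ∈-edges⁺ (v<u , ~-sym u~v) , inj₂ refl

  link⇒~ : ∀ {e u v} → e ∈ edges G → Links e u v → u ~ v
  link⇒~ e∈ (inj₁ refl) = proj₂ (∈-edges⁻ e∈)
  link⇒~ e∈ (inj₂ refl) = ~-sym (proj₂ (∈-edges⁻ e∈))

  links-unique : ∀ {e f u v} → e ∈ edges G → f ∈ edges G → Links e u v → Links f u v → e ≡ f
  links-unique e∈ f∈ (inj₁ refl) (inj₁ refl) = refl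
  links-unique e∈ f∈ (inj₂ refl) (inj₂ refl) = refl
  links-unique e∈ f∈ (inj₁ refl) (inj₂ refl) =
    contradiction (proj₁ (∈-edges⁻ f∈)) (Fin.<-asym (proj₁ (∈-edges⁻ e∈)))
  links-unique e∈ f∈ (inj₂ refl) (inj₁ refl) =
    contradiction (proj₁ (∈-edges⁻ f∈)) (Fin.<-asym (proj₁ (∈-edges⁻ e∈)))

  independent-⊥ : Independent G Subset.⊥
  independent-⊥ _ _ u∈ = contradiction u∈ Subset.∉⊥

  independent⇒≤α : ∀ {A} → Independent G A → ∣ A ∣ ℕ.≤ α G
  independent⇒≤α {A} ind = ≤-max ∣_∣ (independent? G) (subsets n) (∈-subsets A) ind

  ∃-maximum : ∃ (MaximumIndependent G)
  ∃-maximum with A , _ , ind , eq ← max-attained ∣_∣ (independent? G) (subsets n)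
                   (∈-subsets Subset.⊥) independent-⊥ (Subset.∣⊥∣≡0 n) = A , ind , eq

  module _ {M : List (Edge n)} (M∈ : M ∈ matchings G) where

    matching⊆edges : ∀ {e} → e ∈ M → e ∈ edges G
    matching⊆edges = Sublist.Any-resp-⊆ (∈-sublists⁻ (edges G) (proj₁ (∈-filter⁻ (AllPairs.allPairs? nonIncident?) {xs = sublists (edges G)} M∈)))

    matching-nonIncident : AllPairs NonIncident M
    matching-nonIncident = proj₂ (∈-filter⁻ (AllPairs.allPairs? nonIncident?) {xs = sublists (edges G)} M∈)

    unique-matching : Unique M
    unique-matching = AllPairs.map (λ { ((a , _) , _) refl → a refl }) matching-nonIncident

    matching-unique : ∀ {e f u v w} → e ∈ M → f ∈ M → Links e u v → Links f u w → e ≡ f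
    matching-unique e∈ f∈ l l′ with allPairs-lookup nonIncident-sym matching-nonIncident e∈ f∈
    ... | inj₁ e≡f = e≡f
    ... | inj₂ ni  = contradiction ni (links⇒incident l l′)

  ∃-maximum-matching : ∃ λ M → M ∈ matchings G × length M ≡ μ G
  ∃-maximum-matching with M , M∈ , ni , eq ← max-attained length (AllPairs.allPairs? nonIncident?) (sublists (edges G))
                            (∈-sublists⁺ (Sublist.minimum (edges G))) [] refl =
    M , ∈-filter⁺ (AllPairs.allPairs? nonIncident?) M∈ ni , eq

  module _ {S : Subset n} (ind : Independent G S) where

    -- The end outside S, the first one if both are.
    Outer : Edge n → Fin n → Set
    Outer (u , w) v = v ∉ˢ S × (u ≡ v ⊎ (u ∈ˢ S × w ≡ v))

    ∃-outer : ∀ {e} → e ∈ edges G → ∃ (Outer e)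
    ∃-outer {u , w} e∈ with u ∈? S
    ... | no u∉  = u , u∉ , inj₁ refl
    ... | yes u∈ = w , (λ w∈ → ind u w u∈ w∈ (proj₂ (∈-edges⁻ e∈))) , inj₂ (u∈ , refl)

    outer-functional : ∀ {e v w} → Outer e v → Outer e w → v ≡ w
    outer-functional (_  , inj₁ refl)      (_  , inj₁ refl)     = refl
    outer-functional (v∉ , inj₁ refl)      (_  , inj₂ (u∈ , _)) = contradiction u∈ v∉
    outer-functional (_  , inj₂ (u∈ , _))  (w∉ , inj₁ refl)     = contradiction u∈ w∉
    outer-functional (_  , inj₂ (_ , refl)) (_ , inj₂ (_ , refl)) = refl

    outer⇒links : ∀ {e v} → Outer e v → ∃ (Links e v)
    outer⇒links {e = _ , w} (_ , inj₁ refl)       = w , inj₁ refl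
    outer⇒links {e = u , _} (_ , inj₂ (_ , refl)) = u , inj₂ refl

    module _ {M : List (Edge n)} (M∈ : M ∈ matchings G) where

      private
        Hits : Fin n ⊎ Edge n → Fin n → Set
        Hits (inj₁ s) v = s ≡ v
        Hits (inj₂ e) v = Outer e v

        total : Total Hits (elements S ⊕ M) (allFin n)
        total {inj₁ s} _ = s , ∈-allFin _ , refl
        total {inj₂ e} q with v , o ← ∃-outer (matching⊆edges M∈ (∈-⊕⁻ʳ {xs = elements S} q)) =
          v , ∈-allFin _ , o

        leftUnique : LeftUnique Hits (elements S ⊕ M)
        leftUnique {inj₁ _} {inj₁ _} _ _ refl refl = refl
        leftUnique {inj₁ _} {inj₂ _} p _ refl (v∉ , _) = contradiction (∈-elements⁻ S (∈-⊕⁻ˡ p)) v∉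
        leftUnique {inj₂ _} {inj₁ _} _ q (v∉ , _) refl = contradiction (∈-elements⁻ S (∈-⊕⁻ˡ q)) v∉
        leftUnique {inj₂ _} {inj₂ _} p q o o′ = cong inj₂
          (matching-unique M∈ (∈-⊕⁻ʳ {xs = elements S} p) (∈-⊕⁻ʳ {xs = elements S} q)
            (proj₂ (outer⇒links o)) (proj₂ (outer⇒links o′)))

        unique : Unique (elements S ⊕ M)
        unique = unique-⊕ (unique-elements S) (unique-matching M∈)

        length-sum : length (elements S ⊕ M) ≡ ∣ S ∣ ℕ.+ length M
        length-sum = trans (length-⊕ {xs = elements S}) (cong (ℕ._+ length M) (length-elements S))

      -- Every matching edge has an end outside `S`, and these ends are distinct, so the members of
      -- `S` and the matching edges inject into the vertices.
      independent+matching≤n : ∣ S ∣ ℕ.+ length M ℕ.≤ n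
      independent+matching≤n = subst₂ ℕ._≤_ length-sum (length-tabulate id) (length-≤ Hits unique total leftUnique)

      -- In the case of equality that injection is onto, and a vertex outside `S` can only be hit by
      -- an edge.
      ∃-outer-edge : n ℕ.≤ ∣ S ∣ ℕ.+ length M → ∀ {v} → v ∉ˢ S → ∃ λ e → e ∈ M × Outer e v
      ∃-outer-edge n≤ {v} v∉
        with covered Hits unique total leftUnique (subst₂ ℕ._≤_ (sym (length-tabulate id)) (sym length-sum) n≤) (∈-allFin v)
      ... | inj₁ _ , p , refl = contradiction (∈-elements⁻ S (∈-⊕⁻ˡ p)) v∉
      ... | inj₂ e , p , o    = e , ∈-⊕⁻ʳ {xs = elements S} p , o

      -- The condition on `v` stands inside the existential, so that the first projection is a
      -- function on all vertices, as `Saturates` requires.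
      partner : n ℕ.≤ ∣ S ∣ ℕ.+ length M → ∀ v → ∃ λ w → v ∉ˢ S → w ∈ˢ S × ∃ λ e → e ∈ M × Links e v w
      partner n≤ v with v ∈? S
      ... | yes v∈ = v , contradiction v∈
      ... | no v∉ with e , e∈ , o ← ∃-outer-edge n≤ v∉ with w , l ← outer⇒links o =
        w , λ _ → decidable-stable (w ∈? S) w∉⇒⊥ , e , e∈ , l
        where
        w∉⇒⊥ : ¬ (w ∉ˢ S)
        -- If the other end `w` were outside `S` too, it would be the outer end of a matching edge,
        -- which can only be `e`. But `e` has a single outer end, so `v` and `w` would coincide and
        -- `e` would be a loop.
        w∉⇒⊥ w∉ with e′ , e′∈ , o′ ← ∃-outer-edge n≤ w∉
          with refl ← matching-unique M∈ e∈ e′∈ (links-sym l) (proj₂ (outer⇒links o′)) =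
          ~-irr (outer-functional o o′) (link⇒~ (matching⊆edges M∈ e∈) l)

      ∃-saturating′ : n ℕ.≤ ∣ S ∣ ℕ.+ length M → ∃ (Saturates G S)
      ∃-saturating′ n≤ = proj₁ ∘ partner n≤ , record
        { to-∈   = λ {v} v∉ → proj₁ (proj₂ (partner n≤ v) v∉)
        ; to-adj = λ {v} v∉ → let _ , e , e∈ , l = proj₂ (partner n≤ v) v∉ in link⇒~ (matching⊆edges M∈ e∈) l
        ; to-inj = λ {v} {w} v∉ w∉ eq →
            let _ , e , e∈ , l  = proj₂ (partner n≤ v) v∉
                _ , f , f∈ , l′ = proj₂ (partner n≤ w) w∉
                k   = subst (Links e v) eq l
                e≡f = matching-unique M∈ e∈ f∈ (links-sym k) (links-sym l′)
            in links-cancelʳ k (subst (λ e → Links e w _) (sym e≡f) l′)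
        }

    independent+μ≤n : ∣ S ∣ ℕ.+ μ G ℕ.≤ n
    independent+μ≤n with M , M∈ , eq ← ∃-maximum-matching =
      subst (λ k → ∣ S ∣ ℕ.+ k ℕ.≤ n) eq (independent+matching≤n M∈)

    ∃-saturating : n ℕ.≤ ∣ S ∣ ℕ.+ μ G → ∃ (Saturates G S)
    ∃-saturating n≤ with M , M∈ , eq ← ∃-maximum-matching =
      ∃-saturating′ M∈ (subst (λ k → n ℕ.≤ ∣ S ∣ ℕ.+ k) (sym eq) n≤)

  α+μ≤n : α G ℕ.+ μ G ℕ.≤ n
  α+μ≤n with S , ind , eq ← ∃-maximum = subst (λ k → k ℕ.+ μ G ℕ.≤ n) eq (independent+μ≤n ind)

  module _ (S : Subset n) (g : Fin n → Fin n) {xs : List (Fin n)} (unique : Unique xs)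
           (out : ∀ {v} → v ∈ xs → v ∉ˢ S) (to∈ : ∀ {v} → v ∈ xs → g v ∈ˢ S)
           (adj : ∀ {v} → v ∈ xs → v ~ g v)
           (inj : ∀ {v w} → v ∈ xs → w ∈ xs → g v ≡ g w → v ≡ w) where

    private
      Used : Edge n → Set
      Used e = ∃ λ v → v ∈ xs × Links e v (g v)

      used? : U.Decidable Used
      used? e = any? λ v → (v ∈ᴸ? xs) ×-dec links? e v (g v)

      same : ∀ {e f} → e ∈ filter used? (edges G) → f ∈ filter used? (edges G) → ¬ NonIncident e f → e ≡ f
      same e∈ f∈ inc with ∈-filter⁻ used? {xs = edges G} e∈ | ∈-filter⁻ used? {xs = edges G} f∈ | incident⇒links inc
      ... | e∈′ , v , v∈ , l | f∈′ , w , w∈ , l′ | u , _ , _ , k , k′ with links-ends l k | links-ends l′ k′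
      ...   | inj₁ (refl , _) | inj₁ (refl , _) = links-unique e∈′ f∈′ l l′
      ...   | inj₁ (refl , _) | inj₂ (eq , _)   = contradiction (subst (_∈ˢ S) (sym eq) (to∈ w∈)) (out v∈)
      ...   | inj₂ (eq , _)   | inj₁ (refl , _) = contradiction (subst (_∈ˢ S) (sym eq) (to∈ v∈)) (out w∈)
      ...   | inj₂ (eq , _)   | inj₂ (eq′ , _)  with refl ← inj v∈ w∈ (trans (sym eq) eq′) = links-unique e∈′ f∈′ l l′

    -- A filter of `edges G` is automatically a sublist, hence a candidate in `matchings G`. The
    -- vertices form an arbitrary list because edge deletion needs the bound for the complement of
    -- `S` without one vertex.
    length≤μ : length xs ℕ.≤ μ G
    length≤μ = ℕ.≤-trans
      (length-≤ (λ v e → Links e v (g v)) unique total leftUnique)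
      (≤-max length (AllPairs.allPairs? nonIncident?) (sublists (edges G))
        (∈-sublists⁺ (Sublist.filter-⊆ used? (edges G)))
        (unique⇒allPairs (Unique.filter⁺ used? unique-edges)
          λ p q e≢f → decidable-stable (nonIncident? _ _) (e≢f ∘ same p q)))
      where
      total : Total (λ v e → Links e v (g v)) xs (filter used? (edges G))
      total v∈ with e , e∈ , l ← ~⇒link (adj v∈) = e , ∈-filter⁺ used? e∈ (_ , v∈ , l) , l

      leftUnique : LeftUnique (λ v e → Links e v (g v)) xs
      leftUnique p q l l′ with links-ends l l′
      ... | inj₁ (w≡v , _)  = sym w≡v
      ... | inj₂ (w≡gv , _) = contradiction (subst (_∈ˢ S) (sym w≡gv) (to∈ p)) (out q)

  saturates⇒∣∁∣≤μ : ∀ {S g} → Saturates G S g → ∣ ∁ S ∣ ℕ.≤ μ G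
  saturates⇒∣∁∣≤μ {S} {g} sat = subst (ℕ._≤ μ G) (length-elements (∁ S))
    (length≤μ S g (unique-elements (∁ S)) out (to-∈ sat ∘ out) (to-adj sat ∘ out) λ p q → to-inj sat (out p) (out q))
    where
    out : ∀ {v} → v ∈ elements (∁ S) → v ∉ˢ S
    out = Subset.x∈∁p⇒x∉p ∘ ∈-elements⁻ (∁ S)

-- Critical sets, the core and the kernel

difference-≤⁺ : ∀ {a p b q} → a ℕ.+ q ℕ.≤ b ℕ.+ p → + a - + p ≤ + b - + q
difference-≤⁺ {a} {p} {b} {q} le = subst₂ _≤_ (eq₁ (+ a) (+ p) (+ q)) (eq₂ (+ b) (+ p) (+ q))
  (ℤ.+-monoˡ-≤ (ℤ.- + p - + q) (ℤ.+≤+ le))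
  where
  eq₁ : ∀ a p q → (a + q) + (ℤ.- p - q) ≡ a - p
  eq₁ = solve-∀
  eq₂ : ∀ b p q → (b + p) + (ℤ.- p - q) ≡ b - q
  eq₂ = solve-∀

difference-≤⁻ : ∀ {a p b q} → + a - + p ≤ + b - + q → a ℕ.+ q ℕ.≤ b ℕ.+ p
difference-≤⁻ {a} {p} {b} {q} le = ℤ.drop‿+≤+ (subst₂ _≤_ (eq₁ (+ a) (+ p) (+ q)) (eq₂ (+ b) (+ p) (+ q))
  (ℤ.+-monoˡ-≤ (+ p + + q) le))
  where
  eq₁ : ∀ a p q → (a - p) + (p + q) ≡ a + q
  eq₁ = solve-∀
  eq₂ : ∀ b p q → (b - q) + (p + q) ≡ b + p
  eq₂ = solve-∀

module _ (G : Graph n) where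
  open Graph G

  ∈-N⁺ : ∀ {A u v} → u ∈ˢ A → u ~ v → v ∈ˢ N G A
  ∈-N⁺ {A} u∈ u~v = ∈-tabulate⁺ (λ v → any? λ u → (u ∈? A) ×-dec (u ~? v)) (_ , u∈ , u~v)

  ∈-N⁻ : ∀ {A v} → v ∈ˢ N G A → ∃ λ u → u ∈ˢ A × u ~ v
  ∈-N⁻ {A} = ∈-tabulate⁻ (λ v → any? λ u → (u ∈? A) ×-dec (u ~? v))

  ∈-core⁺ : ∀ {v} → (∀ {A} → MaximumIndependent G A → v ∈ˢ A) → v ∈ˢ core G
  ∈-core⁺ f = ∈-⋂⁺ λ p → f (proj₂ (∈-filter⁻ (maximumIndependent? G) {xs = subsets n} p))

  ∈-core⁻ : ∀ {v A} → v ∈ˢ core G → MaximumIndependent G A → v ∈ˢ A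
  ∈-core⁻ {A = A} v∈ max = ∈-⋂⁻ (∈-filter⁺ (maximumIndependent? G) (∈-subsets A) max) v∈

  ∈-ker⁺ : ∀ {v} → (∀ {A} → CriticalIndependent G A → v ∈ˢ A) → v ∈ˢ ker G
  ∈-ker⁺ f = ∈-⋂⁺ λ p → f (proj₂ (∈-filter⁻ (criticalIndependent? G) {xs = subsets n} p))

  ∈-ker⁻ : ∀ {v A} → v ∈ˢ ker G → CriticalIndependent G A → v ∈ˢ A
  ∈-ker⁻ {A = A} v∈ crit = ∈-⋂⁻ (∈-filter⁺ (criticalIndependent? G) (∈-subsets A) crit) v∈

  ∉-core⇒ : ∀ {v} → v ∉ˢ core G → ∃ λ A → MaximumIndependent G A × v ∉ˢ A
  ∉-core⇒ {v} v∉ with Subset.anySubset? (λ A → maximumIndependent? G A ×-dec ¬? (v ∈? A))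
  ... | yes found = found
  ... | no none   = contradiction (∈-core⁺ λ {A} max → decidable-stable (v ∈? A) λ v∉A → none (A , max , v∉A)) v∉

  difference≤d : ∀ A → difference G A ≤ d G
  difference≤d A = All.lookup (Extrema.xs≤max ℤ.≤-totalOrder (+ 0) (map (difference G) (subsets n)))
                              (∈-map⁺ (difference G) (∈-subsets A))

  d≤ : ∀ {c} → (∀ A → difference G A ≤ c) → d G ≤ c
  -- The maximum in `d` starts from 0, so `c` must also be shown nonnegative; the empty set, whose
  -- neighbourhood is empty, provides this.
  d≤ {c} f = Extrema.max≤v⁺ ℤ.≤-totalOrder (ℤ.≤-trans 0≤difference-⊥ (f Subset.⊥)) (All.tabulate bound)
    where
    N-⊥ : N G Subset.⊥ Subset.⊆ Subset.⊥
    N-⊥ v∈ = let _ , u∈ , _ = ∈-N⁻ v∈ in contradiction u∈ Subset.∉⊥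
    0≤difference-⊥ : + 0 ≤ difference G Subset.⊥
    0≤difference-⊥ = difference-≤⁺ {0} {0} {∣ Subset.⊥ {n} ∣} {∣ N G Subset.⊥ ∣}
      (ℕ.≤-trans (Subset.p⊆q⇒∣p∣≤∣q∣ N-⊥) (ℕ.≤-reflexive (sym (ℕ.+-identityʳ _))))
    bound : ∀ {x} → x ∈ map (difference G) (subsets n) → x ≤ c
    bound x∈ with A , _ , refl ← ∈-map⁻ (difference G) x∈ = f A

module _ (G : Graph n) {S : Subset n} {g : Fin n → Fin n} (ind : Independent G S) (sat : Saturates G S g) where
  open Graph G

  private
    ∉S : ∀ {v} → v ∈ elements (∁ S) → v ∉ˢ S
    ∉S = Subset.x∈∁p⇒x∉p ∘ ∈-elements⁻ (∁ S)

  module _ (A : Subset n) where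

    private
      -- Injects `A` and the complement of `S` into `N G A` and `S`. A member of `A` stays put if it
      -- is in `S`, and otherwise moves to its partner in `N G A`. A vertex `v` outside `S` stays
      -- put, now in `N G A`, if `g v` is in `A`, and otherwise moves to `g v` in `S`.
      Moves : Fin n ⊎ Fin n → Fin n ⊎ Fin n → Set
      Moves (inj₁ a) (inj₁ w) = a ∉ˢ S × w ≡ g a
      Moves (inj₁ a) (inj₂ w) = a ≡ w
      Moves (inj₂ v) (inj₁ w) = v ≡ w
      Moves (inj₂ v) (inj₂ w) = g v ∉ˢ A × w ≡ g v

      xs ys : List (Fin n ⊎ Fin n)
      xs = elements A ⊕ elements (∁ S)
      ys = elements (N G A) ⊕ elements S

      unique : Unique xs
      unique = unique-⊕ (unique-elements A) (unique-elements (∁ S))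

      total : Total Moves xs ys
      total {inj₁ a} p with a ∈? S
      ... | yes a∈ = inj₂ a , ∈-⊕⁺ʳ {xs = elements (N G A)} (∈-elements⁺ a∈) , refl
      ... | no a∉  = inj₁ (g a) , ∈-⊕⁺ˡ (∈-elements⁺ (∈-N⁺ G (∈-elements⁻ A (∈-⊕⁻ˡ p)) (to-adj sat a∉))) , a∉ , refl
      total {inj₂ v} p with g v ∈? A
      ... | yes gv∈ = inj₁ v , ∈-⊕⁺ˡ (∈-elements⁺ (∈-N⁺ G gv∈ (~-sym (to-adj sat (∉S (∈-⊕⁻ʳ {xs = elements A} p)))))) , refl
      ... | no gv∉  = inj₂ (g v) , ∈-⊕⁺ʳ {xs = elements (N G A)} (∈-elements⁺ (to-∈ sat (∉S (∈-⊕⁻ʳ {xs = elements A} p)))) , gv∉ , refl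

      leftUnique : LeftUnique Moves xs
      leftUnique {inj₁ _} {inj₁ _} {inj₁ _} p q (a∉ , refl) (a′∉ , eq) = cong inj₁ (to-inj sat a∉ a′∉ eq)
      leftUnique {inj₁ _} {inj₁ _} {inj₂ _} p q refl refl = refl
      leftUnique {inj₁ _} {inj₂ _} {inj₁ _} p q (a∉ , refl) refl = contradiction (to-∈ sat a∉) (∉S (∈-⊕⁻ʳ {xs = elements A} q))
      leftUnique {inj₁ _} {inj₂ _} {inj₂ _} p q refl (gv∉ , refl) = contradiction (∈-elements⁻ A (∈-⊕⁻ˡ p)) gv∉
      leftUnique {inj₂ _} {inj₁ _} {inj₁ _} p q refl (a∉ , refl) = contradiction (to-∈ sat a∉) (∉S (∈-⊕⁻ʳ {xs = elements A} p))
      leftUnique {inj₂ _} {inj₁ _} {inj₂ _} p q (gv∉ , refl) refl = contradiction (∈-elements⁻ A (∈-⊕⁻ˡ q)) gv∉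
      leftUnique {inj₂ _} {inj₂ _} {inj₁ _} p q refl refl = refl
      leftUnique {inj₂ _} {inj₂ _} {inj₂ _} p q (_ , refl) (_ , eq) =
        cong inj₂ (to-inj sat (∉S (∈-⊕⁻ʳ {xs = elements A} p)) (∉S (∈-⊕⁻ʳ {xs = elements A} q)) eq)

      length-xs : length xs ≡ ∣ A ∣ ℕ.+ ∣ ∁ S ∣
      length-xs = trans (length-⊕ {xs = elements A}) (cong₂ ℕ._+_ (length-elements A) (length-elements (∁ S)))

      length-ys : length ys ≡ ∣ N G A ∣ ℕ.+ ∣ S ∣
      length-ys = trans (length-⊕ {xs = elements (N G A)}) (cong₂ ℕ._+_ (length-elements (N G A)) (length-elements S))

    difference≤∣S∣-∣∁S∣ : difference G A ≤ + ∣ S ∣ - + ∣ ∁ S ∣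
    difference≤∣S∣-∣∁S∣ = difference-≤⁺ {∣ A ∣} {∣ N G A ∣} {∣ S ∣} {∣ ∁ S ∣} (subst (∣ A ∣ ℕ.+ ∣ ∁ S ∣ ℕ.≤_) (ℕ.+-comm ∣ N G A ∣ ∣ S ∣)
      (subst₂ ℕ._≤_ length-xs length-ys (length-≤ Moves unique total leftUnique)))

    -- Tightness makes the injection onto, so the copy of `z` in `S` is hit. Only a member of `A` or
    -- a vertex matched to `z` can hit it, and the latter is excluded.
    difference-tight⇒ : + ∣ S ∣ - + ∣ ∁ S ∣ ≤ difference G A → ∀ {z} → z ∈ˢ S →
                        (∀ {v} → v ∉ˢ S → z ≢ g v) → z ∈ˢ A
    difference-tight⇒ le {z} z∈ z≢ with covered Moves unique total leftUnique
      (subst₂ ℕ._≤_ (trans (ℕ.+-comm ∣ S ∣ ∣ N G A ∣) (sym length-ys)) (sym length-xs)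
        (difference-≤⁻ {∣ S ∣} {∣ ∁ S ∣} {∣ A ∣} le)) (∈-⊕⁺ʳ {xs = elements (N G A)} (∈-elements⁺ z∈))
    ... | inj₁ _ , p , refl     = ∈-elements⁻ A (∈-⊕⁻ˡ p)
    ... | inj₂ _ , p , _ , z≡ = contradiction z≡ (z≢ (∉S (∈-⊕⁻ʳ {xs = elements A} p)))

  large⇒critical : ∀ {A} → Independent G A → + ∣ S ∣ - + ∣ ∁ S ∣ ≤ difference G A → CriticalIndependent G A
  large⇒critical {A} indA le = indA ,
    ℤ.≤-antisym (difference≤d G A) (d≤ G λ B → ℤ.≤-trans (difference≤∣S∣-∣∁S∣ B) le)

  ∣S∣-∣∁S∣≤difference : + ∣ S ∣ - + ∣ ∁ S ∣ ≤ difference G S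
  ∣S∣-∣∁S∣≤difference = difference-≤⁺ {∣ S ∣} {∣ ∁ S ∣} {∣ S ∣} {∣ N G S ∣} (ℕ.+-monoʳ-≤ ∣ S ∣ (Subset.p⊆q⇒∣p∣≤∣q∣ λ {v} v∈ →
    let u , u∈ , u~v = ∈-N⁻ G v∈ in Subset.x∉p⇒x∈∁p λ v∈S → ind u v u∈ v∈S u~v))

  unmatched∈ker : ∀ {z} → z ∈ˢ S → (∀ {v} → v ∉ˢ S → z ≢ g v) → z ∈ˢ ker G
  unmatched∈ker z∈ z≢ = ∈-ker⁺ G λ {A} (_ , eq) →
    difference-tight⇒ A (ℤ.≤-trans (ℤ.≤-trans ∣S∣-∣∁S∣≤difference (difference≤d G S)) (ℤ.≤-reflexive (sym eq))) z∈ z≢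

  ker⊆S : ∀ {v} → v ∈ˢ ker G → v ∈ˢ S
  ker⊆S v∈ = ∈-ker⁻ G v∈ (large⇒critical ind ∣S∣-∣∁S∣≤difference)

  -- If the neighbours in S of a set T outside S are all matched into T, then S ∖ g(T) is critical.
  module _ {T : List (Fin n)} (T⊆∁S : ∀ {t} → t ∈ T → t ∉ˢ S)
           (closed : ∀ {t x} → t ∈ T → x ∈ˢ S → t ~ x → x ∈ map g T) where

    private
      InW : Fin n → Set
      InW v = v ∈ˢ S × v ∉ map g T

      inW? : U.Decidable InW
      inW? v = (v ∈? S) ×-dec ¬? (v ∈ᴸ? map g T)

      W : Subset n
      W = tabulate (does ∘ inW?)

      Moves : Fin n ⊎ Fin n → Fin n ⊎ Fin n → Set
      Moves (inj₁ s) (inj₁ w) = s ≡ w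
      Moves (inj₁ s) (inj₂ w) = w ∈ T × s ≡ g w
      Moves (inj₂ v) (inj₁ w) = ⊥
      Moves (inj₂ v) (inj₂ w) = v ≡ w

      xs ys : List (Fin n ⊎ Fin n)
      xs = elements S ⊕ elements (N G W)
      ys = elements W ⊕ elements (∁ S)

      ∈NW⇒ : ∀ {v} → inj₂ v ∈ xs → v ∉ˢ S × v ∉ T
      ∈NW⇒ {v} p with u , u∈ , u~v ← ∈-N⁻ G (∈-elements⁻ (N G W) (∈-⊕⁻ʳ {xs = elements S} p))
                 with u∈S , u∉ ← ∈-tabulate⁻ inW? u∈ =
        (λ v∈ → ind u v u∈S v∈ u~v) , λ v∈ → u∉ (closed v∈ u∈S (~-sym u~v))

      total : Total Moves xs ys
      total {inj₁ s} p with s ∈ᴸ? map g T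
      ... | no s∉ = inj₁ s , ∈-⊕⁺ˡ (∈-elements⁺ (∈-tabulate⁺ inW? (∈-elements⁻ S (∈-⊕⁻ˡ p) , s∉))) , refl
      ... | yes s∈ with t , t∈ , eq ← ∈-map⁻ g s∈ =
        inj₂ t , ∈-⊕⁺ʳ {xs = elements W} (∈-elements⁺ (Subset.x∉p⇒x∈∁p (T⊆∁S t∈))) , t∈ , eq
      total {inj₂ v} p =
        inj₂ v , ∈-⊕⁺ʳ {xs = elements W} (∈-elements⁺ (Subset.x∉p⇒x∈∁p (proj₁ (∈NW⇒ p)))) , refl

      leftUnique : LeftUnique Moves xs
      leftUnique {inj₁ _} {inj₁ _} {inj₁ _} p q refl refl = refl
      leftUnique {inj₁ _} {inj₁ _} {inj₂ _} p q (_ , refl) (_ , refl) = refl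
      leftUnique {inj₁ _} {inj₂ _} {inj₂ _} p q (t∈ , _) refl = contradiction t∈ (proj₂ (∈NW⇒ q))
      leftUnique {inj₂ _} {inj₁ _} {inj₂ _} p q refl (t∈ , _) = contradiction t∈ (proj₂ (∈NW⇒ p))
      leftUnique {inj₂ _} {inj₂ _} {inj₂ _} p q refl refl = refl

      -- Members of `S` outside `W` are traded for their partners in `T`. There is no collision with
      -- `N G W`: by `closed`, a neighbour in `S` of a vertex of `T` is not in `W`.
      count : ∣ S ∣ ℕ.+ ∣ N G W ∣ ℕ.≤ ∣ W ∣ ℕ.+ ∣ ∁ S ∣
      count = subst₂ ℕ._≤_
        (trans (length-⊕ {xs = elements S}) (cong₂ ℕ._+_ (length-elements S) (length-elements (N G W))))
        (trans (length-⊕ {xs = elements W}) (cong₂ ℕ._+_ (length-elements W) (length-elements (∁ S))))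
        (length-≤ Moves (unique-⊕ (unique-elements S) (unique-elements (N G W))) total leftUnique)

      critical : CriticalIndependent G W
      critical = large⇒critical
        (λ u v u∈ v∈ → ind u v (proj₁ (∈-tabulate⁻ inW? u∈)) (proj₁ (∈-tabulate⁻ inW? v∈)))
        (difference-≤⁺ {∣ S ∣} {∣ ∁ S ∣} {∣ W ∣} {∣ N G W ∣} count)

    ker⊆S∖gT : ∀ {v} → v ∈ˢ ker G → v ∉ map g T
    ker⊆S∖gT v∈ = proj₂ (∈-tabulate⁻ inW? (∈-ker⁻ G v∈ critical))

  module _ {S′ : Subset n} (ind′ : Independent G S′) (∣S∣≤∣S′∣ : ∣ S ∣ ℕ.≤ ∣ S′ ∣) where

    private
      Moves : Fin n → Fin n → Set
      Moves s z = s ≡ z ⊎ (s ∉ˢ S × z ≡ g s)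

      total : Total Moves (elements S′) (elements S)
      total {s} p with s ∈? S
      ... | yes s∈ = s , ∈-elements⁺ s∈ , inj₁ refl
      ... | no s∉  = g s , ∈-elements⁺ (to-∈ sat s∉) , inj₂ (s∉ , refl)

      leftUnique : LeftUnique Moves (elements S′)
      leftUnique p q (inj₁ refl)       (inj₁ refl)       = refl
      leftUnique p q (inj₁ refl)       (inj₂ (s∉ , refl)) =
        contradiction (to-adj sat s∉) (ind′ _ _ (∈-elements⁻ S′ q) (∈-elements⁻ S′ p))
      leftUnique p q (inj₂ (s∉ , refl)) (inj₁ refl) =
        contradiction (to-adj sat s∉) (ind′ _ _ (∈-elements⁻ S′ p) (∈-elements⁻ S′ q))
      leftUnique p q (inj₂ (s∉ , refl)) (inj₂ (s′∉ , eq)) = to-inj sat s∉ s′∉ eq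

    -- Fixing the common part and sending the rest of `S′` along `g` maps `S′` injectively into `S`:
    -- a collision would put both `s` and its neighbour `g s` into `S′`. As `S′` is no smaller than
    -- `S`, the map is onto.
    maximum-exchange : ∀ {z} → z ∈ˢ S → z ∈ˢ S′ ⊎ ∃ λ s → s ∈ˢ S′ × s ∉ˢ S × z ≡ g s
    maximum-exchange z∈ with covered Moves (unique-elements S′) total leftUnique
      (subst₂ ℕ._≤_ (sym (length-elements S)) (sym (length-elements S′)) ∣S∣≤∣S′∣) (∈-elements⁺ z∈)
    ... | s , p , inj₁ refl       = inj₁ (∈-elements⁻ S′ p)
    ... | s , p , inj₂ (s∉ , z≡) = inj₂ (s , ∈-elements⁻ S′ p , s∉ , z≡)

-- Alternating trees

set : (Fin n → B) → Fin n → B → Fin n → B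
set h t x = updateAt h t λ _ → x

-- The edge from `b` to `g b` is the one exception in `closed`. Once it is deleted, no vertex of `T`
-- has a neighbour in `S` beyond the partners of the other tree vertices.
record ClosedTree (G : Graph n) (S : Subset n) (g : Fin n → Fin n) (b : Fin n) (P : Fin n → Set) (T : List (Fin n)) : Set where
  open Graph G
  field
    root    : b ∈ T
    outside : ∀ {t} → t ∈ T → t ∉ˢ S
    within  : ∀ {t} → t ∈ T → P t
    closed  : ∀ {t x} → t ∈ T → x ∈ˢ S → t ~ x → (t ≡ b × x ≡ g b) ⊎ ∃ λ t′ → t′ ∈ T × t′ ≢ b × x ≡ g t′

module _ (G : Graph n) {S : Subset n} {g : Fin n → Fin n} (sat : Saturates G S g)
         {b : Fin n} (b∉S : b ∉ˢ S)
         -- Every other maximum matching also uses the edge b g(b).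
         (forced : ∀ {g′} → Saturates G S g′ → g′ b ≡ g b)
         {P : Fin n → Set} (Pb : P b) (step : ∀ {t t′} → P t → t′ ∉ˢ S → Graph._~_ G t (g t′) → P t′) where
  open Graph G

  -- A matching of the complement of S without t, differing from g only on T and using neither g(b) nor a vertex unmatched by g.
  record Shifted (T : List (Fin n)) (t : Fin n) : Set where
    field
      to    : Fin n → Fin n
      image : ∀ {v} → v ∉ˢ S → v ≢ t → ∃ λ w → w ∉ˢ S × w ≢ b × to v ≡ g w
      adj   : ∀ {v} → v ∉ˢ S → v ≢ t → v ~ to v
      inj   : ∀ {v w} → v ∉ˢ S → w ∉ˢ S → v ≢ t → w ≢ t → to v ≡ to w → v ≡ w
      agree : ∀ {v} → v ∉ˢ S → v ∉ T → to v ≡ g v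

  -- `unique` is kept for termination: it limits the length of `T` to the number of vertices.
  record Tree (T : List (Fin n)) : Set where
    field
      unique  : Unique T
      root    : b ∈ T
      outside : ∀ {t} → t ∈ T → t ∉ˢ S
      within  : ∀ {t} → t ∈ T → P t
      shifted : ∀ {t} → t ∈ T → Shifted T t

  private
    singleton : Tree (b ∷ [])
    singleton = record
      { unique  = [] ∷ []
      ; root    = here refl
      ; outside = λ { (here refl) → b∉S }
      ; within  = λ { (here refl) → Pb }
      ; shifted = λ { (here refl) → record
          { to    = g
          ; image = λ {v} v∉ v≢b → v , v∉ , v≢b , refl
          ; adj   = λ v∉ _ → to-adj sat v∉
          ; inj   = λ v∉ w∉ _ _ → to-inj sat v∉ w∉
          ; agree = λ _ _ → refl
          } }
      }

    module _ {T : List (Fin n)} (tree : Tree T) {t : Fin n} (t∈ : t ∈ T) where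
      open Tree tree
      open Shifted (shifted t∈)

      -- To free `t′`, take the injection that frees `t` and let `t` have `g t′`.
      extend : ∀ {t′} → t′ ∉ˢ S → t′ ≢ b → t′ ∉ T → t ~ g t′ → Tree (t′ ∷ T)
      extend {t′} t′∉S t′≢b t′∉T t~gt′ = record
        { unique  = All.tabulate (λ { s∈ refl → t′∉T s∈ }) ∷ unique
        ; root    = there root
        ; outside = λ { (here refl) → t′∉S ; (there s∈) → outside s∈ }
        ; within  = λ { (here refl) → step (within t∈) t′∉S t~gt′ ; (there s∈) → within s∈ }
        ; shifted = λ { (here refl) → shifted′ ; (there s∈) → weaken (shifted s∈) }
        }
        where
        weaken : ∀ {s} → Shifted T s → Shifted (t′ ∷ T) s
        weaken h = record
          { to = to h ; image = image h ; adj = adj h ; inj = inj h ; agree = λ v∉S v∉ → agree h v∉S (v∉ ∘ there) }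
          where open Shifted

        to′ : Fin n → Fin n
        to′ = set to t (g t′)

        at : to′ t ≡ g t′
        at = updateAt-updates t to

        off : ∀ {v} → v ≢ t → to′ v ≡ to v
        off v≢t = updateAt-minimal _ t to v≢t

        t≢t′ : t ≢ t′
        t≢t′ refl = t′∉T t∈

        new : ∀ {w} → w ∉ˢ S → w ≢ t → w ≢ t′ → g t′ ≢ to w
        -- By `agree`, the injection freeing `t` still sends `t′` to `g t′`, because `t′` was not in
        -- the tree; so no other vertex holds that value.
        new w∉ w≢t w≢t′ eq = w≢t′ (sym (inj t′∉S w∉ (t≢t′ ∘ sym) w≢t (trans (agree t′∉S t′∉T) eq)))

        shifted′ : Shifted (t′ ∷ T) t′
        shifted′ = record
          { to    = to′
          ; image = image′
          ; adj   = adj′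
          ; inj   = inj′
          ; agree = λ {v} v∉S v∉ → trans (off λ { refl → v∉ (there t∈) }) (agree v∉S (v∉ ∘ there))
          }
          where
          image′ : ∀ {v} → v ∉ˢ S → v ≢ t′ → ∃ λ w → w ∉ˢ S × w ≢ b × to′ v ≡ g w
          image′ {v} v∉ v≢t′ with v ≟ t
          ... | yes refl = t′ , t′∉S , t′≢b , at
          ... | no v≢t with w , w∉ , w≢b , eq ← image v∉ v≢t = w , w∉ , w≢b , trans (off v≢t) eq

          adj′ : ∀ {v} → v ∉ˢ S → v ≢ t′ → v ~ to′ v
          adj′ {v} v∉ v≢t′ with v ≟ t
          ... | yes refl = subst (t ~_) (sym at) t~gt′
          ... | no v≢t   = subst (v ~_) (sym (off v≢t)) (adj v∉ v≢t)

          inj′ : ∀ {v w} → v ∉ˢ S → w ∉ˢ S → v ≢ t′ → w ≢ t′ → to′ v ≡ to′ w → v ≡ w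
          inj′ {v} {w} v∉ w∉ v≢t′ w≢t′ eq with v ≟ t | w ≟ t
          ... | yes refl | yes refl = refl
          ... | yes refl | no w≢t   = contradiction (trans (sym at) (trans eq (off w≢t))) (new w∉ w≢t w≢t′)
          ... | no v≢t   | yes refl = contradiction (trans (sym at) (trans (sym eq) (off v≢t))) (new v∉ v≢t v≢t′)
          ... | no v≢t   | no w≢t   = inj v∉ w∉ v≢t w≢t (trans (sym (off v≢t)) (trans eq (off w≢t)))

      -- Such an `x` is either `g b` or unmatched by `g`. The injection freeing `t` takes only
      -- values `g w` with `w ≢ b`, so `x` is available for `t`.
      augment : ∀ {x} → x ∈ˢ S → t ~ x → (∀ {w} → w ∉ˢ S → w ≢ b → x ≢ g w) → Saturates G S (set to t x)
      augment {x} x∈ t~x x≢ = record { to-∈ = to-∈′ ; to-adj = to-adj′ ; to-inj = to-inj′ }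
        where
        at : set to t x t ≡ x
        at = updateAt-updates t to

        off : ∀ {v} → v ≢ t → set to t x v ≡ to v
        off v≢t = updateAt-minimal _ t to v≢t

        new : ∀ {w} → w ∉ˢ S → w ≢ t → x ≢ to w
        new w∉ w≢t eq with w′ , w′∉ , w′≢b , eq′ ← image w∉ w≢t = x≢ w′∉ w′≢b (trans eq eq′)

        to-∈′ : ∀ {v} → v ∉ˢ S → set to t x v ∈ˢ S
        to-∈′ {v} v∉ with v ≟ t
        ... | yes refl = subst (_∈ˢ S) (sym at) x∈
        ... | no v≢t with w , w∉ , _ , eq ← image v∉ v≢t = subst (_∈ˢ S) (sym (trans (off v≢t) eq)) (to-∈ sat w∉)

        to-adj′ : ∀ {v} → v ∉ˢ S → v ~ set to t x v
        to-adj′ {v} v∉ with v ≟ t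
        ... | yes refl = subst (t ~_) (sym at) t~x
        ... | no v≢t   = subst (v ~_) (sym (off v≢t)) (adj v∉ v≢t)

        to-inj′ : ∀ {v w} → v ∉ˢ S → w ∉ˢ S → set to t x v ≡ set to t x w → v ≡ w
        to-inj′ {v} {w} v∉ w∉ eq with v ≟ t | w ≟ t
        ... | yes refl | yes refl = refl
        ... | yes refl | no w≢t   = contradiction (trans (sym at) (trans eq (off w≢t))) (new w∉ w≢t)
        ... | no v≢t   | yes refl = contradiction (trans (sym at) (trans (sym eq) (off v≢t))) (new v∉ v≢t)
        ... | no v≢t   | no w≢t   = inj v∉ w∉ v≢t w≢t (trans (sym (off v≢t)) (trans eq (off w≢t)))

      -- The completed injection must still send `b` to `g b`. If `t` is `b`, this forces `x` to be
      -- `g b`, the excluded edge; otherwise `b` has a value `g w` with `w ≢ b`, against injectivity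
      -- of `g`.
      no-augmentation : ∀ {x} → x ∈ˢ S → t ~ x → ¬ (t ≡ b × x ≡ g b) → ¬ (∀ {w} → w ∉ˢ S → w ≢ b → x ≢ g w)
      no-augmentation {x} x∈ t~x not-edge x≢ with b ≟ t
      ... | yes refl = not-edge (refl , trans (sym (updateAt-updates t to)) (forced (augment x∈ t~x x≢)))
      ... | no b≢t with w , w∉ , w≢b , eq ← image b∉S b≢t =
        w≢b (to-inj sat w∉ b∉S (trans (sym eq) (trans (sym (updateAt-minimal b t to b≢t)) (forced (augment x∈ t~x x≢)))))

    module _ (T : List (Fin n)) where

      Inside Leaves : Fin n → Fin n → Set
      Inside x t′ = t′ ∈ T × t′ ≢ b × x ≡ g t′
      Leaves t x = t ∈ T × x ∈ˢ S × t ~ x × ¬ (t ≡ b × x ≡ g b) × ¬ ∃ (Inside x)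

      inside? : ∀ x → Dec (∃ (Inside x))
      inside? x = any? λ t′ → (t′ ∈ᴸ? T) ×-dec (¬? (t′ ≟ b) ×-dec (x ≟ g t′))

      leaves? : Dec (∃₂ Leaves)
      leaves? = any? λ t → any? λ x → (t ∈ᴸ? T) ×-dec ((x ∈? S) ×-dec ((t ~? x) ×-dec
        (¬? ((t ≟ b) ×-dec (x ≟ g b)) ×-dec ¬? (inside? x))))

      closed-or-extends : Tree T → ClosedTree G S g b P T ⊎ ∃ λ t′ → Tree (t′ ∷ T)
      closed-or-extends tree with leaves?
      ... | no none = inj₁ record
        { root = root ; outside = outside ; within = within
        ; closed = λ {t} {x} t∈ x∈ t~x → decidable-stable (((t ≟ b) ×-dec (x ≟ g b)) ⊎-dec inside? x)
            λ bad → none (t , x , t∈ , x∈ , t~x , bad ∘ inj₁ , bad ∘ inj₂)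
        }
        where open Tree tree
      ... | yes (t , x , t∈ , x∈ , t~x , not-edge , not-inside)
        with any? (λ t′ → ¬? (t′ ∈? S) ×-dec (¬? (t′ ≟ b) ×-dec (x ≟ g t′)))
      ...   | yes (t′ , t′∉S , t′≢b , refl) =
        inj₂ (t′ , extend tree t∈ t′∉S t′≢b (λ t′∈ → not-inside (t′ , t′∈ , t′≢b , refl)) t~x)
      ...   | no none = contradiction (λ {w} w∉ w≢b eq → none (w , w∉ , w≢b , eq))
                                      (no-augmentation tree t∈ x∈ t~x not-edge)

    -- `k` bounds the number of vertices still missing from the tree, so the recursion is on it.
    grow : ∀ k {T} → Tree T → n ℕ.≤ length T ℕ.+ k → ∃ (ClosedTree G S g b P)
    grow k {T} tree n≤ with closed-or-extends T tree
    ... | inj₁ closed = T , closed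
    grow (ℕ.suc k) {T} tree n≤ | inj₂ (t′ , tree′) = grow k tree′ (subst (n ℕ.≤_) (ℕ.+-suc (length T) k) n≤)
    grow ℕ.zero    {T} tree n≤ | inj₂ (t′ , tree′) = contradiction
      (subst (length (t′ ∷ T) ℕ.≤_) (length-tabulate {n = n} id)
        (length-≤ _≡_ (Tree.unique tree′) (λ {v} _ → v , ∈-allFin v , refl) λ _ _ p q → trans p (sym q)))
      (ℕ.<⇒≱ (ℕ.s≤s (subst (n ℕ.≤_) (ℕ.+-identityʳ _) n≤)))

  ∃-closed-tree : ∃ (ClosedTree G S g b P)
  ∃-closed-tree = grow n singleton (ℕ.m≤n+m n _)

-- Critical edges of König–Egerváry graphs

∈-edgesBetween⁻ : ∀ (G : Graph n) (A B : Subset n) {e} → e ∈ edgesBetween G A B →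
                  e ∈ edges G × ∃₂ λ a b → Links e b a × a ∈ˢ A × b ∈ˢ B
∈-edgesBetween⁻ G A B {u , v} e∈ with ∈-filter⁻ (joins? A B) {xs = edges G} e∈
... | e∈′ , inj₁ (u∈ , v∈) = e∈′ , u , v , inj₂ refl , u∈ , v∈
... | e∈′ , inj₂ (v∈ , u∈) = e∈′ , v , u , inj₁ refl , v∈ , u∈

∈-edgesBetween⁺ : ∀ (G : Graph n) (A B : Subset n) {e a b} → e ∈ edges G → Links e b a → a ∈ˢ A → b ∈ˢ B →
                  e ∈ edgesBetween G A B
∈-edgesBetween⁺ G A B e∈ (inj₁ refl) a∈ b∈ = ∈-filter⁺ (joins? A B) e∈ (inj₂ (a∈ , b∈))
∈-edgesBetween⁺ G A B e∈ (inj₂ refl) a∈ b∈ = ∈-filter⁺ (joins? A B) e∈ (inj₁ (a∈ , b∈))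

independent-deletion : ∀ (G : Graph n) e {A} → Independent G A → Independent (G -ₑ e) A
independent-deletion G e ind u v u∈ v∈ (u~v , _) = ind u v u∈ v∈ u~v

-- The chain n = |S| + |V ∖ S| ≤ α + μ ≤ n collapses to equalities.
saturates⇒konigEgervary : ∀ (G : Graph n) {S g} → Independent G S → Saturates G S g →
                          ∣ S ∣ ≡ α G × KonigEgervary G
saturates⇒konigEgervary {n} G {S} ind sat = ℕ.≤-antisym ∣S∣≤α α≤∣S∣ , ℕ.≤-antisym (α+μ≤n G) n≤α+μ
  where
  ∣S∣≤α : ∣ S ∣ ℕ.≤ α G
  ∣S∣≤α = independent⇒≤α G ind
  ∣∁S∣≤μ : ∣ ∁ S ∣ ℕ.≤ μ G
  ∣∁S∣≤μ = saturates⇒∣∁∣≤μ G sat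
  n≤α+μ : n ℕ.≤ α G ℕ.+ μ G
  n≤α+μ = subst (ℕ._≤ α G ℕ.+ μ G) (∣p∣+∣∁p∣≡n S) (ℕ.+-mono-≤ ∣S∣≤α ∣∁S∣≤μ)
  α≤∣S∣ : α G ℕ.≤ ∣ S ∣
  α≤∣S∣ = ℕ.+-cancelʳ-≤ (μ G) _ _ (ℕ.≤-trans (α+μ≤n G)
    (subst (ℕ._≤ ∣ S ∣ ℕ.+ μ G) (∣p∣+∣∁p∣≡n S) (ℕ.+-monoʳ-≤ ∣ S ∣ ∣∁S∣≤μ)))

module _ (G : Graph n) (ke : KonigEgervary G) where
  open Graph G

  module _ {S : Subset n} (max : MaximumIndependent G S) where

    private
      ind : Independent G S
      ind = proj₁ max

    n≤∣S∣+μ : n ℕ.≤ ∣ S ∣ ℕ.+ μ G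
    n≤∣S∣+μ = ℕ.≤-reflexive (sym (trans (cong (ℕ._+ μ G) (proj₂ max)) ke))

    ∣∁S∣≡μ : ∣ ∁ S ∣ ≡ μ G
    ∣∁S∣≡μ = ℕ.+-cancelˡ-≡ ∣ S ∣ _ _ (trans (∣p∣+∣∁p∣≡n S) (trans (sym ke) (cong (ℕ._+ μ G) (sym (proj₂ max)))))

    maximum⇒saturating : ∃ (Saturates G S)
    maximum⇒saturating = ∃-saturating G ind n≤∣S∣+μ

    module _ {e : Edge n} (crit : MuCritical G e) where

      -- Otherwise the whole injection survives in `G -ₑ e` and yields a matching of size |V ∖ S| =
      -- μ(G) there.
      critical⇒used : ∀ {g} → Saturates G S g → ∃ λ v → v ∉ˢ S × Links e v (g v)
      critical⇒used {g} sat with any? (λ v → ¬? (v ∈? S) ×-dec links? e v (g v))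
      ... | yes used = used
      ... | no none  = contradiction crit (ℕ.≤⇒≯ (subst (ℕ._≤ μ (G -ₑ e)) ∣∁S∣≡μ (saturates⇒∣∁∣≤μ (G -ₑ e) sat′)))
        where
        sat′ : Saturates (G -ₑ e) S g
        sat′ = record
          { to-∈   = to-∈ sat
          ; to-adj = λ {v} v∉ → to-adj sat v∉ , (λ eq → none (v , v∉ , inj₁ (sym eq))) , λ eq → none (v , v∉ , inj₂ (sym eq))
          ; to-inj = to-inj sat
          }

      critical-forced : ∀ {a b g} → Links e b a → b ∉ˢ S → Saturates G S g → g b ≡ a
      critical-forced {g = g} l b∉ sat with v , v∉ , l′ ← critical⇒used sat with links-ends l′ l
      ... | inj₁ (refl , a≡gb) = sym a≡gb
      ... | inj₂ (b≡gv , _)    = contradiction (subst (_∈ˢ S) (sym b≡gv) (to-∈ sat v∉)) b∉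

      critical-ends : ∀ {a b} → Links e b a → a ∉ˢ S → b ∈ˢ S
      critical-ends l a∉ = let g , sat = maximum⇒saturating in
        subst (_∈ˢ S) (critical-forced (links-sym l) a∉ sat) (to-∈ sat a∉)

  ker⊆core : ∀ {v} → v ∈ˢ ker G → v ∈ˢ core G
  ker⊆core v∈ = ∈-core⁺ G λ max → ker⊆S G (proj₁ max) (proj₂ (maximum⇒saturating max)) v∈

  module _ {e a b} (e∈ : e ∈ edges G) (crit : MuCritical G e) (l : Links e b a) where

    private
      b~a : b ~ a
      b~a = link⇒~ G e∈ l

      module _ {S g} (max : MaximumIndependent G S) (sat : Saturates G S g) (b∉ : b ∉ˢ S) where

        closed-tree⇒∉N-ker : ∃ (ClosedTree G S g b (λ _ → ⊤)) → ∀ {k} → k ∈ˢ ker G → ¬ (b ~ k)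
        closed-tree⇒∉N-ker (T , tree) k∈ b~k =
          ker⊆S∖gT G (proj₁ max) sat outside matched k∈ (matched root (ker⊆S G (proj₁ max) sat k∈) b~k)
          where
          open ClosedTree tree
          matched : ∀ {t x} → t ∈ T → x ∈ˢ S → t ~ x → x ∈ map g T
          matched t∈ x∈ t~x = Sum.[ (λ { (_ , refl) → ∈-map⁺ g root }) , (λ { (_ , t′∈ , _ , refl) → ∈-map⁺ g t′∈ }) ]
            (closed t∈ x∈ t~x)

        forced : ∀ {g′} → Saturates G S g′ → g′ b ≡ g b
        forced sat′ = trans (critical-forced max crit l b∉ sat′) (sym (critical-forced max crit l b∉ sat))

    critical-at-core⇒∉N-ker : a ∈ˢ core G → ∀ {k} → k ∈ˢ ker G → ¬ (b ~ k)
    critical-at-core⇒∉N-ker a∈ =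
      let S , max = ∃-maximum G
          g , sat = maximum⇒saturating max
          b∉ = λ b∈ → proj₁ max _ _ b∈ (∈-core⁻ G a∈ max) b~a
      in closed-tree⇒∉N-ker max sat b∉ (∃-closed-tree G sat b∉ (forced max sat b∉) {P = λ _ → ⊤} tt λ _ _ _ → tt)

    critical-at-core⇒∉ker : a ∈ˢ core G → a ∉ˢ ker G
    critical-at-core⇒∉ker a∈ a∈ker = critical-at-core⇒∉N-ker a∈ a∈ker b~a

  -- Counting the critical edges at the core, for (iv)

  coreCriticalEdges : List (Edge n)
  coreCriticalEdges = filter (muCritical? G) (edgesBetween G (core G) (N G (core G)))

  private
    ∈-coreCriticalEdges⁻ : ∀ {e} → e ∈ coreCriticalEdges → e ∈ edgesBetween G (core G) (N G (core G)) × MuCritical G e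
    ∈-coreCriticalEdges⁻ = ∈-filter⁻ (muCritical? G) {xs = edgesBetween G (core G) (N G (core G))}

    ∈-edges : ∀ {e} → e ∈ coreCriticalEdges → e ∈ edges G
    ∈-edges p = proj₁ (∈-edgesBetween⁻ G (core G) (N G (core G)) (proj₁ (∈-coreCriticalEdges⁻ p)))

    CoreEnd : Edge n ⊎ Fin n → Fin n → Set
    CoreEnd (inj₁ e) a = a ∈ˢ core G × ∃ λ b → Links e b a
    CoreEnd (inj₂ k) a = k ≡ a

    xs : List (Edge n ⊎ Fin n)
    xs = coreCriticalEdges ⊕ elements (ker G)

    ∈-ker : ∀ {k} → inj₂ k ∈ xs → k ∈ˢ ker G
    ∈-ker p = ∈-elements⁻ (ker G) (∈-⊕⁻ʳ {xs = coreCriticalEdges} p)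

    coreEnd-total : Total CoreEnd xs (elements (core G))
    coreEnd-total {inj₁ e} p =
      let _ , a , b , l , a∈ , _ = ∈-edgesBetween⁻ G (core G) (N G (core G)) (proj₁ (∈-coreCriticalEdges⁻ (∈-⊕⁻ˡ p)))
      in a , ∈-elements⁺ a∈ , a∈ , b , l
    coreEnd-total {inj₂ k} p = k , ∈-elements⁺ (ker⊆core (∈-ker p)) , refl

    disjoint : ∀ {e a b} → inj₁ e ∈ xs → inj₂ a ∈ xs → a ∈ˢ core G → ¬ Links e b a
    disjoint p q a∈ l = critical-at-core⇒∉ker (∈-edges (∈-⊕⁻ˡ p)) (proj₂ (∈-coreCriticalEdges⁻ (∈-⊕⁻ˡ p))) l a∈ (∈-ker q)

    -- One saturating injection uses both edges, and it sends only one vertex to `a`.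
    same-end : ∀ {e f a b c} → e ∈ coreCriticalEdges → f ∈ coreCriticalEdges → a ∈ˢ core G → Links e b a → Links f c a → e ≡ f
    same-end {e} {f} {a} p q a∈ l k =
      let S , max = ∃-maximum G
          g , sat = maximum⇒saturating max
          outside : ∀ {e b} → e ∈ coreCriticalEdges → Links e b a → b ∉ˢ S
          outside p l b∈ = proj₁ max _ _ b∈ (∈-core⁻ G a∈ max) (link⇒~ G (∈-edges p) l)
          forced : ∀ {e b} → e ∈ coreCriticalEdges → Links e b a → g b ≡ a
          forced p l = critical-forced max (proj₂ (∈-coreCriticalEdges⁻ p)) l (outside p l) sat
          b≡c = to-inj sat (outside p l) (outside q k) (trans (forced p l) (sym (forced q k)))
      in links-unique G (∈-edges p) (∈-edges q) l (subst (λ c → Links f c a) (sym b≡c) k)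

    coreEnd-leftUnique : LeftUnique CoreEnd xs
    coreEnd-leftUnique {inj₁ _} {inj₁ _} p q (a∈ , _ , l) (_ , _ , k) = cong inj₁ (same-end (∈-⊕⁻ˡ p) (∈-⊕⁻ˡ q) a∈ l k)
    coreEnd-leftUnique {inj₁ _} {inj₂ _} p q (a∈ , _ , l) refl = contradiction l (disjoint p q a∈)
    coreEnd-leftUnique {inj₂ _} {inj₁ _} p q refl (a∈ , _ , l) = contradiction l (disjoint q p a∈)
    coreEnd-leftUnique {inj₂ _} {inj₂ _} p q refl refl = refl

    unique-xs : Unique xs
    unique-xs = unique-⊕
      (Unique.filter⁺ (muCritical? G) (Unique.filter⁺ (joins? (core G) (N G (core G))) (unique-edges G)))
      (unique-elements (ker G))

  -- The core has room for both families: the core ends of critical edges are distinct and avoid the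
  -- kernel, and the kernel lies in the core.
  coreCriticalCount+ε≤ξ : coreCriticalCount G ℕ.+ ε G ℕ.≤ ξ G
  coreCriticalCount+ε≤ξ = subst₂ ℕ._≤_
    (trans (length-⊕ {xs = coreCriticalEdges}) (cong (coreCriticalCount G ℕ.+_) (length-elements (ker G))))
    (length-elements (core G)) (length-≤ CoreEnd unique-xs coreEnd-total coreEnd-leftUnique)

  -- Deleting an edge, for (v)

  noncritical-deletion : ∀ {e} → ¬ MuCritical G e → KonigEgervary (G -ₑ e)
  noncritical-deletion {e} noncrit = let S , ind , eq = ∃-maximum G in
    ℕ.≤-antisym (α+μ≤n (G -ₑ e)) (subst (ℕ._≤ α (G -ₑ e) ℕ.+ μ (G -ₑ e)) (trans (cong (ℕ._+ μ G) eq) ke)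
      (ℕ.+-mono-≤ (independent⇒≤α (G -ₑ e) (independent-deletion G e ind)) (ℕ.≮⇒≥ noncrit)))

  module _ {e a b S S′} (e∈ : e ∈ edges G) (crit : MuCritical G e) (l : Links e b a)
           (max : MaximumIndependent G S) (b∉ : b ∉ˢ S) (max′ : MaximumIndependent G S′) (b∈′ : b ∈ˢ S′) where

    private
      -- As `t` is in `S′`, its neighbour `g t′` is not. The exchange between `S` and `S′` then
      -- places the vertex matched to `g t′` in `S′`, and that vertex is `t′`.
      step : ∀ {g t t′} → Saturates G S g → t ∈ˢ S′ → t′ ∉ˢ S → t ~ g t′ → t′ ∈ˢ S′
      step sat t∈ t′∉ t~ with maximum-exchange G (proj₁ max) sat (proj₁ max′)
                                (ℕ.≤-reflexive (trans (proj₂ max) (sym (proj₂ max′)))) (to-∈ sat t′∉)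
      ... | inj₁ gt′∈            = contradiction t~ (proj₁ max′ _ _ t∈ gt′∈)
      ... | inj₂ (s , s∈ , s∉ , eq) = subst (_∈ˢ S′) (to-inj sat s∉ t′∉ (sym eq)) s∈

      module _ {g} (sat : Saturates G S g) {T} (tree : ClosedTree G S g b (_∈ˢ S′) T) where
        open ClosedTree tree

        Moved InI : Fin n → Set
        Moved v = ∃ λ t → t ∈ T × t ≢ b × v ≡ g t
        InI v = v ∈ T ⊎ (v ∈ˢ S × ¬ Moved v)

        moved? : U.Decidable Moved
        moved? v = any? λ t → (t ∈ᴸ? T) ×-dec (¬? (t ≟ b) ×-dec (v ≟ g t))

        inI? : U.Decidable InI
        inI? v = (v ∈ᴸ? T) ⊎-dec ((v ∈? S) ×-dec ¬? (moved? v))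

        I : Subset n
        I = tabulate (does ∘ inI?)

        nonadjacent : ∀ {t v} → t ∈ T → v ∈ˢ S → ¬ Moved v → t ~ v → e ≡ (t , v) ⊎ e ≡ (v , t)
        nonadjacent t∈ v∈ unmoved t~v with closed t∈ v∈ t~v
        ... | inj₁ (refl , refl) = subst (Links e b) (sym (critical-forced max crit l b∉ sat)) l
        ... | inj₂ moved         = contradiction moved unmoved

        independent-I : Independent (G -ₑ e) I
        independent-I u v u∈ v∈ (u~v , ≢₁ , ≢₂) with ∈-tabulate⁻ inI? u∈ | ∈-tabulate⁻ inI? v∈
        ... | inj₁ u∈T         | inj₁ v∈T         = proj₁ max′ u v (within u∈T) (within v∈T) u~v
        ... | inj₂ (u∈S , _)   | inj₂ (v∈S , _)   = proj₁ max u v u∈S v∈S u~v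
        ... | inj₁ u∈T         | inj₂ (v∈S , unm) = Sum.[ ≢₁ ∘ sym , ≢₂ ∘ sym ] (nonadjacent u∈T v∈S unm u~v)
        ... | inj₂ (u∈S , unm) | inj₁ v∈T         = Sum.[ ≢₂ ∘ sym , ≢₁ ∘ sym ] (nonadjacent v∈T u∈S unm (~-sym u~v))

        Moves : ⊤ ⊎ Fin n → Fin n → Set
        Moves (inj₁ _) v = v ≡ b
        Moves (inj₂ s) v = s ≡ v ⊎ (v ∈ T × v ≢ b × s ≡ g v)

        total : Total Moves ((tt ∷ []) ⊕ elements S) (elements I)
        total {inj₁ _} _ = b , ∈-elements⁺ (∈-tabulate⁺ inI? (inj₁ root)) , refl
        total {inj₂ s} p with moved? s
        ... | yes (t , t∈ , t≢b , eq) = t , ∈-elements⁺ (∈-tabulate⁺ inI? (inj₁ t∈)) , inj₂ (t∈ , t≢b , eq)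
        ... | no unmoved = s , ∈-elements⁺ (∈-tabulate⁺ inI? (inj₂ (∈-elements⁻ S (∈-⊕⁻ʳ {xs = tt ∷ []} p) , unmoved))) , inj₁ refl

        ∈S : ∀ {s} → inj₂ s ∈ (tt ∷ []) ⊕ elements S → s ∈ˢ S
        ∈S = ∈-elements⁻ S ∘ ∈-⊕⁻ʳ {xs = tt ∷ []}

        leftUnique : LeftUnique Moves ((tt ∷ []) ⊕ elements S)
        leftUnique {inj₁ _} {inj₁ _} _ _ _ _ = refl
        leftUnique {inj₁ _} {inj₂ _} p q refl (inj₁ refl)             = contradiction (∈S q) b∉
        leftUnique {inj₁ _} {inj₂ _} p q refl (inj₂ (_ , v≢b , _))    = contradiction refl v≢b
        leftUnique {inj₂ _} {inj₁ _} p q (inj₁ refl) refl             = contradiction (∈S p) b∉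
        leftUnique {inj₂ _} {inj₁ _} p q (inj₂ (_ , v≢b , _)) refl    = contradiction refl v≢b
        leftUnique {inj₂ _} {inj₂ _} p q (inj₁ refl) (inj₁ refl)      = refl
        leftUnique {inj₂ _} {inj₂ _} p q (inj₁ refl) (inj₂ (t∈ , _))  = contradiction (∈S p) (outside t∈)
        leftUnique {inj₂ _} {inj₂ _} p q (inj₂ (t∈ , _)) (inj₁ refl)  = contradiction (∈S q) (outside t∈)
        leftUnique {inj₂ _} {inj₂ _} p q (inj₂ (_ , _ , refl)) (inj₂ (_ , _ , refl)) = refl

        -- Each tree vertex other than `b` replaces its partner, while `b` enters without `g b`
        -- leaving.
        ∣I∣≥ : ℕ.suc ∣ S ∣ ℕ.≤ ∣ I ∣
        ∣I∣≥ = subst₂ ℕ._≤_ (trans (length-⊕ {xs = tt ∷ []} {ys = elements S}) (cong ℕ.suc (length-elements S))) (length-elements I)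
          (length-≤ Moves (unique-⊕ ([] ∷ []) (unique-elements S)) total leftUnique)

        others : List (Fin n)
        others = filter (λ v → ¬? (v ≟ b)) (elements (∁ S))

        ∈-others⁻ : ∀ {v} → v ∈ others → v ∉ˢ S × v ≢ b
        ∈-others⁻ p with q , v≢b ← ∈-filter⁻ (λ v → ¬? (v ≟ b)) {xs = elements (∁ S)} p =
          Subset.x∈∁p⇒x∉p (∈-elements⁻ (∁ S) q) , v≢b

        ∣∁S∣≤ : ∣ ∁ S ∣ ℕ.≤ ℕ.suc (length others)
        ∣∁S∣≤ = subst (ℕ._≤ ℕ.suc (length others)) (length-elements (∁ S)) (length-≤ _≡_ (unique-elements (∁ S)) inc λ _ _ p q → trans p (sym q))
          where
          inc : Total _≡_ (elements (∁ S)) (b ∷ others)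
          inc {v} v∈ with v ≟ b
          ... | yes refl = v , here refl , refl
          ... | no v≢b   = v , there (∈-filter⁺ (λ v → ¬? (v ≟ b)) v∈ v≢b) , refl

        others≤μ : length others ℕ.≤ μ (G -ₑ e)
        others≤μ = length≤μ (G -ₑ e) S g (Unique.filter⁺ (λ v → ¬? (v ≟ b)) (unique-elements (∁ S)))
          (proj₁ ∘ ∈-others⁻) (to-∈ sat ∘ proj₁ ∘ ∈-others⁻)
          (λ p → let v∉ , v≢b = ∈-others⁻ p in
            to-adj sat v∉ , (λ eq → not-e v∉ v≢b (inj₁ (sym eq))) , λ eq → not-e v∉ v≢b (inj₂ (sym eq)))
          (λ p q → to-inj sat (proj₁ (∈-others⁻ p)) (proj₁ (∈-others⁻ q)))
          where
          not-e : ∀ {v} → v ∉ˢ S → v ≢ b → ¬ Links e v (g v)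
          not-e v∉ v≢b l′ with links-ends l′ l
          ... | inj₁ (b≡v , _)  = v≢b (sym b≡v)
          ... | inj₂ (b≡gv , _) = b∉ (subst (_∈ˢ S) (sym b≡gv) (to-∈ sat v∉))

        -- The matching loses only the edge at `b`, and the extra vertex of `I` makes up for that.
        tree⇒konigEgervary : KonigEgervary (G -ₑ e)
        tree⇒konigEgervary = ℕ.≤-antisym (α+μ≤n (G -ₑ e)) (begin
          n                               ≡⟨ ∣p∣+∣∁p∣≡n S ⟨
          ∣ S ∣ ℕ.+ ∣ ∁ S ∣               ≤⟨ ℕ.+-monoʳ-≤ ∣ S ∣ ∣∁S∣≤ ⟩
          ∣ S ∣ ℕ.+ ℕ.suc (length others) ≡⟨ ℕ.+-suc ∣ S ∣ (length others) ⟩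
          ℕ.suc ∣ S ∣ ℕ.+ length others   ≤⟨ ℕ.+-mono-≤ (ℕ.≤-trans ∣I∣≥ (independent⇒≤α (G -ₑ e) independent-I)) others≤μ ⟩
          α (G -ₑ e) ℕ.+ μ (G -ₑ e)       ∎)
          where open ℕ.≤-Reasoning

    critical-deletion : KonigEgervary (G -ₑ e)
    critical-deletion =
      let g , sat = maximum⇒saturating max
          T , tree = ∃-closed-tree G sat b∉
            (λ sat′ → trans (critical-forced max crit l b∉ sat′) (sym (critical-forced max crit l b∉ sat)))
            {P = _∈ˢ S′} b∈′ (step sat)
      in tree⇒konigEgervary sat tree

  ¬konigEgervary-deletion : ∀ {e} → e ∈ edges G → ¬ KonigEgervary (G -ₑ e) → e ∈ coreCriticalEdges
  ¬konigEgervary-deletion {u , v} e∈ not-ke = ∈-filter⁺ (muCritical? G) (between (u ∈? core G) (v ∈? core G)) crit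
    where
    crit : MuCritical G (u , v)
    crit = decidable-stable (muCritical? G (u , v)) (not-ke ∘ noncritical-deletion)

    u~v : u ~ v
    u~v = proj₂ (∈-edges⁻ G e∈)

    between : Dec (u ∈ˢ core G) → Dec (v ∈ˢ core G) → (u , v) ∈ edgesBetween G (core G) (N G (core G))
    between (yes u∈) _        = ∈-edgesBetween⁺ G (core G) (N G (core G)) e∈ (inj₂ refl) u∈ (∈-N⁺ G u∈ u~v)
    between (no _)   (yes v∈) = ∈-edgesBetween⁺ G (core G) (N G (core G)) e∈ (inj₁ refl) v∈ (∈-N⁺ G v∈ (~-sym u~v))
    -- A maximum independent set that misses `v` contains `u`, since a critical edge cannot have
    -- both ends outside it. So `u` is missed by one maximum independent set and contained in
    -- another.
    between (no u∉)  (no v∉)  =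
      let S , max , u∉S = ∉-core⇒ G u∉
          S′ , max′ , v∉S′ = ∉-core⇒ G v∉
      in contradiction (critical-deletion e∈ crit (inj₁ refl) max u∉S max′ (critical-ends max′ crit (inj₁ refl) v∉S′)) not-ke

  m≤ϱₑ+coreCriticalCount : m G ℕ.≤ ϱₑ G ℕ.+ coreCriticalCount G
  m≤ϱₑ+coreCriticalCount = subst (m G ℕ.≤_) (length-++ survivors)
    (length-≤ _≡_ (unique-edges G) (λ {e} e∈ → e , split e∈ (konigEgervary? (G -ₑ e)) , refl) λ _ _ p q → trans p (sym q))
    where
    survivors : List (Edge n)
    survivors = filter (λ e → konigEgervary? (G -ₑ e)) (edges G)

    split : ∀ {e} → e ∈ edges G → Dec (KonigEgervary (G -ₑ e)) → e ∈ survivors ++ coreCriticalEdges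
    split e∈ (yes ke′) = ∈-++⁺ˡ (∈-filter⁺ (λ e → konigEgervary? (G -ₑ e)) e∈ ke′)
    split e∈ (no ¬ke′) = ∈-++⁺ʳ survivors (¬konigEgervary-deletion e∈ ¬ke′)

-- A graph attaining the bound of (iv)

avoiding-unique : ∀ {p q r : Fin 2} → q ≢ p → r ≢ p → q ≡ r
avoiding-unique {_}        {zero}     {zero}     _ _ = refl
avoiding-unique {_}        {suc zero} {suc zero} _ _ = refl
avoiding-unique {zero}     {zero}     {suc zero} a _ = contradiction refl a
avoiding-unique {zero}     {suc zero} {zero}     _ b = contradiction refl b
avoiding-unique {suc zero} {zero}     {suc zero} _ b = contradiction refl b
avoiding-unique {suc zero} {suc zero} {zero}     a _ = contradiction refl a

-- Each hub is joined to its own leaf and to both ends, which are adjacent: exactly one end lies in a maximum independent set, so no hub does.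
module Spider (i x : ℕ) where

  size : ℕ
  size = (i ℕ.+ x) ℕ.+ (x ℕ.+ 2)

  Vertex : Set
  Vertex = (Fin i ⊎ Fin x) ⊎ (Fin x ⊎ Fin 2)

  pattern isolated j = inj₁ (inj₁ j)
  pattern leaf j     = inj₁ (inj₂ j)
  pattern hub j      = inj₂ (inj₁ j)
  pattern end p      = inj₂ (inj₂ p)

  data Adjacent : Vertex → Vertex → Set where
    leaf-hub : ∀ {j} → Adjacent (leaf j) (hub j)
    hub-leaf : ∀ {j} → Adjacent (hub j) (leaf j)
    hub-end  : ∀ {j p} → Adjacent (hub j) (end p)
    end-hub  : ∀ {j p} → Adjacent (end p) (hub j)
    end-end  : ∀ {p q} → p ≢ q → Adjacent (end p) (end q)

  adjacent-sym : ∀ {u v} → Adjacent u v → Adjacent v u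
  adjacent-sym leaf-hub      = hub-leaf
  adjacent-sym hub-leaf      = leaf-hub
  adjacent-sym hub-end       = end-hub
  adjacent-sym end-hub       = hub-end
  adjacent-sym (end-end p≢q) = end-end (p≢q ∘ sym)

  adjacent-irr : ∀ {u} → ¬ Adjacent u u
  adjacent-irr (end-end p≢p) = p≢p refl

  adjacent? : ∀ u v → Dec (Adjacent u v)
  adjacent? (isolated _) v            = no λ ()
  adjacent? (leaf j) (isolated _)     = no λ ()
  adjacent? (leaf j) (leaf _)         = no λ ()
  adjacent? (leaf j) (hub k)          = map′ (λ { refl → leaf-hub }) (λ { leaf-hub → refl }) (j ≟ k)
  adjacent? (leaf j) (end _)          = no λ ()
  adjacent? (hub j) (isolated _)      = no λ ()
  adjacent? (hub j) (leaf k)          = map′ (λ { refl → hub-leaf }) (λ { hub-leaf → refl }) (j ≟ k)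
  adjacent? (hub j) (hub _)           = no λ ()
  adjacent? (hub j) (end _)           = yes hub-end
  adjacent? (end p) (isolated _)      = no λ ()
  adjacent? (end p) (leaf _)          = no λ ()
  adjacent? (end p) (hub _)           = yes end-hub
  adjacent? (end p) (end q)           = map′ end-end (λ { (end-end p≢q) → p≢q }) (¬? (p ≟ q))

  abstract
    code : Fin size ↔ Vertex
    code = ↔-trans Fin.+↔⊎ (Fin.+↔⊎ ⊎-↔ Fin.+↔⊎)

  open Inverse code using (to; from) renaming (strictlyInverseˡ to to-from; strictlyInverseʳ to from-to)

  from-injective : ∀ {u v} → from u ≡ from v → u ≡ v
  from-injective {u} {v} eq = trans (sym (to-from u)) (trans (cong to eq) (to-from v))

  to-injective : ∀ {u v} → to u ≡ to v → u ≡ v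
  to-injective {u} {v} eq = trans (sym (from-to u)) (trans (cong from eq) (from-to v))

  spider : Graph size
  spider = record
    { _~_   = λ u v → Adjacent (to u) (to v)
    ; ~-sym = adjacent-sym
    ; ~-irr = λ { refl → adjacent-irr }
    ; _~?_  = λ u v → adjacent? (to u) (to v)
    }

  ~-from : ∀ {u v} → Adjacent u v → Graph._~_ spider (from u) (from v)
  ~-from {u} {v} = subst₂ Adjacent (sym (to-from u)) (sym (to-from v))

  module _ (p : Fin 2) where

    Chosen : Vertex → Set
    Chosen (isolated _) = ⊤
    Chosen (leaf _)     = ⊤
    Chosen (hub _)      = ⊥
    Chosen (end q)      = q ≡ p

    chosen? : U.Decidable Chosen
    chosen? (isolated _) = yes tt
    chosen? (leaf _)     = yes tt
    chosen? (hub _)      = no λ ()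
    chosen? (end q)      = q ≟ p

    S : Subset size
    S = tabulate (does ∘ chosen? ∘ to)

    ∈-S⁺ : ∀ {u} → Chosen u → from u ∈ˢ S
    ∈-S⁺ {u} c = ∈-tabulate⁺ (chosen? ∘ to) (subst Chosen (sym (to-from u)) c)

    ∈-S⁻ : ∀ {v} → v ∈ˢ S → Chosen (to v)
    ∈-S⁻ = ∈-tabulate⁻ (chosen? ∘ to)

    ∉-S⁻ : ∀ {v} → v ∉ˢ S → ¬ Chosen (to v)
    ∉-S⁻ v∉ c = v∉ (∈-tabulate⁺ (chosen? ∘ to) c)

    ∉-S⁺ : ∀ {u} → ¬ Chosen u → from u ∉ˢ S
    ∉-S⁺ {u} ¬c u∈ = ¬c (subst Chosen (to-from u) (∈-S⁻ u∈))

    chosen-independent : ∀ {u v} → Chosen u → Chosen v → ¬ Adjacent u v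
    chosen-independent () _ hub-leaf
    chosen-independent _ () leaf-hub
    chosen-independent () _ hub-end
    chosen-independent _ () end-hub
    chosen-independent q≡p r≡p (end-end q≢r) = q≢r (trans q≡p (sym r≡p))

    independent-S : Independent spider S
    independent-S u v u∈ v∈ = chosen-independent (∈-S⁻ u∈) (∈-S⁻ v∈)

    partnerᵛ : Vertex → Vertex
    partnerᵛ (hub j)  = leaf j
    partnerᵛ (end _)  = end p
    partnerᵛ (inj₁ u) = inj₁ u

    partnerᵛ-chosen : ∀ u → Chosen (partnerᵛ u)
    partnerᵛ-chosen (isolated _) = tt
    partnerᵛ-chosen (leaf _)     = tt
    partnerᵛ-chosen (hub _)      = tt
    partnerᵛ-chosen (end _)      = refl

    partnerᵛ-adjacent : ∀ u → ¬ Chosen u → Adjacent u (partnerᵛ u)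
    partnerᵛ-adjacent (isolated _) ¬c = contradiction tt ¬c
    partnerᵛ-adjacent (leaf _)     ¬c = contradiction tt ¬c
    partnerᵛ-adjacent (hub _)      ¬c = hub-leaf
    partnerᵛ-adjacent (end _)      ¬c = end-end ¬c

    partnerᵛ-injective : ∀ u v → ¬ Chosen u → ¬ Chosen v → partnerᵛ u ≡ partnerᵛ v → u ≡ v
    partnerᵛ-injective (isolated _) _            ¬c _  _    = contradiction tt ¬c
    partnerᵛ-injective (leaf _)     _            ¬c _  _    = contradiction tt ¬c
    partnerᵛ-injective (hub _)      (isolated _) _  ¬c _    = contradiction tt ¬c
    partnerᵛ-injective (hub _)      (leaf _)     _  ¬c _    = contradiction tt ¬c
    partnerᵛ-injective (hub _)      (hub _)      _  _  refl = refl
    partnerᵛ-injective (end _)      (isolated _) _  ¬c _    = contradiction tt ¬c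
    partnerᵛ-injective (end _)      (leaf _)     _  ¬c _    = contradiction tt ¬c
    partnerᵛ-injective (end _)      (end _)      ¬c ¬d _    = cong end′ (avoiding-unique ¬c ¬d)
      where
      end′ : Fin 2 → Vertex
      end′ q = end q

    match : Fin size → Fin size
    match = from ∘ partnerᵛ ∘ to

    match-from : ∀ u → match (from u) ≡ from (partnerᵛ u)
    match-from u = cong (from ∘ partnerᵛ) (to-from u)

    match-saturates : Saturates spider S match
    match-saturates = record
      { to-∈   = λ {v} _ → ∈-S⁺ (partnerᵛ-chosen (to v))
      ; to-adj = λ {v} v∉ → subst (Adjacent (to v)) (sym (to-from _)) (partnerᵛ-adjacent (to v) (∉-S⁻ v∉))
      ; to-inj = λ {v} {w} v∉ w∉ eq →
          to-injective (partnerᵛ-injective (to v) (to w) (∉-S⁻ v∉) (∉-S⁻ w∉) (from-injective eq))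
      }

    maximum-S : MaximumIndependent spider S
    maximum-S = independent-S , proj₁ (saturates⇒konigEgervary spider independent-S match-saturates)

  konigEgervary : KonigEgervary spider
  konigEgervary = proj₂ (saturates⇒konigEgervary spider (independent-S zero) (match-saturates zero))

  private
    p₀ p₁ : Fin 2
    p₀ = zero
    p₁ = suc zero

  exchange : ∀ {A} → MaximumIndependent spider A → ∀ {u} → Chosen p₀ u →
             from u ∈ˢ A ⊎ ∃ λ s → s ∈ˢ A × u ≡ partnerᵛ p₀ (to s) × ¬ Chosen p₀ (to s)
  exchange max c = Sum.map₂ (λ (s , s∈ , s∉ , eq) → s , s∈ , from-injective eq , ∉-S⁻ p₀ s∉)
    (maximum-exchange spider (independent-S p₀) (match-saturates p₀) (proj₁ max)
      (ℕ.≤-reflexive (trans (proj₂ (maximum-S p₀)) (sym (proj₂ max)))) (∈-S⁺ p₀ c))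

  partner≡leaf : ∀ {u j} → leaf j ≡ partnerᵛ p₀ u → ¬ Chosen p₀ u → u ≡ hub j
  partner≡leaf {leaf _} _    ¬c = contradiction tt ¬c
  partner≡leaf {hub _}  refl _  = refl

  partner≡end : ∀ {u} → end p₀ ≡ partnerᵛ p₀ u → ∃ λ p → u ≡ end p
  partner≡end {end p} _ = p , refl

  ∃-end : ∀ {A} → MaximumIndependent spider A → ∃₂ λ s p → s ∈ˢ A × to s ≡ end p
  ∃-end max = Sum.[ (λ e∈ → from (end p₀) , p₀ , e∈ , to-from (end p₀))
                  , (λ (s , s∈ , eq , _) → let p , eq′ = partner≡end eq in s , p , s∈ , eq′)
                  ] (exchange max {end p₀} refl)

  -- If `A` misses the leaf, the exchange puts its hub into `A`; but `A` contains an end as well,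
  -- and hubs are adjacent to both ends.
  leaf∈core : ∀ j → from (leaf j) ∈ˢ core spider
  leaf∈core j = ∈-core⁺ spider λ max → Sum.[ id , (λ (s , s∈ , eq , ¬c) →
    let t , p , t∈ , eqt = ∃-end max
    in contradiction (subst₂ Adjacent (sym (partner≡leaf eq ¬c)) (sym eqt) hub-end) (proj₁ max s t s∈ t∈)) ]
    (exchange max {leaf j} tt)

  isolated≢partner : ∀ {u j} → ¬ Chosen p₀ u → isolated j ≢ partnerᵛ p₀ u
  isolated≢partner {isolated _} ¬c _ = ¬c tt
  isolated≢partner {hub _} _ ()
  isolated≢partner {end _} _ ()

  isolated∈ker : ∀ j → from (isolated j) ∈ˢ ker spider
  isolated∈ker j = unmatched∈ker spider (independent-S p₀) (match-saturates p₀) (∈-S⁺ p₀ tt)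
    λ v∉ eq → isolated≢partner (∉-S⁻ p₀ v∉) (from-injective eq)

  -- The two sets `S p₀` and `S p₁` contain no hub and no common end, which confines the core to
  -- isolated vertices and leaves.
  always-chosen⇒inj₁ : ∀ {u} → Chosen p₀ u → Chosen p₁ u → ∃ λ z → u ≡ inj₁ z
  always-chosen⇒inj₁ {inj₁ z} _    _  = z , refl
  always-chosen⇒inj₁ {end _}  refl ()

  core⇒inj₁ : ∀ {v} → v ∈ˢ core spider → ∃ λ z → v ≡ from (inj₁ z)
  core⇒inj₁ {v} v∈ =
    let z , eq = always-chosen⇒inj₁ (∈-S⁻ p₀ (∈-core⁻ spider v∈ (maximum-S p₀)))
                                    (∈-S⁻ p₁ (∈-core⁻ spider v∈ (maximum-S p₁)))
    in z , trans (sym (from-to v)) (cong from eq)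

  -- Here the closed set T is the whole complement of `S p₀`. Its partners are all the leaves and
  -- `end p₀`, so the resulting critical set consists of the isolated vertices alone.
  leaf∉ker : ∀ j → from (leaf j) ∉ˢ ker spider
  leaf∉ker j l∈ = ker⊆S∖gT spider (independent-S p₀) (match-saturates p₀)
    (Subset.x∈∁p⇒x∉p ∘ ∈-elements⁻ (∁ (S p₀))) closed l∈ (matched {hub j} λ ())
    where
    matched : ∀ {u} → ¬ Chosen p₀ u → from (partnerᵛ p₀ u) ∈ map (match p₀) (elements (∁ (S p₀)))
    matched {u} ¬c = subst (_∈ _) (match-from p₀ u)
      (∈-map⁺ (match p₀) (∈-elements⁺ (Subset.x∉p⇒x∈∁p (∉-S⁺ p₀ ¬c))))

    closed : ∀ {t x} → t ∈ elements (∁ (S p₀)) → x ∈ˢ S p₀ → Adjacent (to t) (to x) →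
             x ∈ map (match p₀) (elements (∁ (S p₀)))
    closed {t} {x} _ x∈ adj = subst (_∈ _) (from-to x) (closedᵛ (to x) (∈-S⁻ p₀ x∈) adj)
      where
      closedᵛ : ∀ u {w} → Chosen p₀ u → Adjacent w u → from u ∈ map (match p₀) (elements (∁ (S p₀)))
      closedᵛ (leaf k) _    _ = matched {hub k} λ ()
      closedᵛ (end _)  refl _ = matched {end p₁} λ ()

  ξ-spider : ξ spider ≡ i ℕ.+ x
  ξ-spider = trans
    (cardinality (unique-⊕ (Unique.allFin⁺ i) (Unique.allFin⁺ x)) (from ∘ inj₁) (inj₁-injective ∘ from-injective)
      into λ v∈ → let z , eq = core⇒inj₁ v∈ in z , all z , eq)
    (trans (length-⊕ {xs = allFin i}) (cong₂ ℕ._+_ (length-tabulate {n = i} id) (length-tabulate {n = x} id)))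
    where
    into : ∀ {z} → z ∈ allFin i ⊕ allFin x → from (inj₁ z) ∈ˢ core spider
    into {inj₁ j} _ = ker⊆core spider konigEgervary (isolated∈ker j)
    into {inj₂ j} _ = leaf∈core j
    all : ∀ z → z ∈ allFin i ⊕ allFin x
    all (inj₁ j) = ∈-⊕⁺ˡ (∈-allFin j)
    all (inj₂ j) = ∈-⊕⁺ʳ {xs = allFin i} (∈-allFin j)

  ε-spider : ε spider ≡ i
  ε-spider = trans
    (cardinality (Unique.allFin⁺ i) (λ j → from (isolated j)) (λ eq → inj₁-injective (inj₁-injective (from-injective eq)))
      (λ {j} _ → isolated∈ker j) onto)
    (length-tabulate id)
    where
    onto : ∀ {v} → v ∈ˢ ker spider → ∃ λ j → j ∈ allFin i × v ≡ from (isolated j)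
    onto v∈ = let z , eq = core⇒inj₁ (ker⊆core spider konigEgervary v∈) in isolated-end z eq v∈
      where
      isolated-end : ∀ {v} z → v ≡ from (inj₁ z) → v ∈ˢ ker spider → ∃ λ j → j ∈ allFin i × v ≡ from (isolated j)
      isolated-end (inj₁ j) eq   _  = j , ∈-allFin j , eq
      isolated-end (inj₂ j) refl v∈ = contradiction v∈ (leaf∉ker j)

  -- Without the edge from its hub to leaf j, both hub j and end p₁ could only be matched to end p₀.
  leaf-edge-critical : ∀ {e j} → Links e (from (hub j)) (from (leaf j)) → MuCritical spider e
  leaf-edge-critical {e} {j} l = decidable-stable (muCritical? spider e) λ noncrit →
    let g , sat = ∃-saturating (spider -ₑ e) (independent-deletion spider e (independent-S p₀))
                    (ℕ.≤-trans (n≤∣S∣+μ spider konigEgervary (maximum-S p₀)) (ℕ.+-monoʳ-≤ ∣ S p₀ ∣ (ℕ.≮⇒≥ noncrit)))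
    in absurd sat
    where
    h∉ : from (hub j) ∉ˢ S p₀
    h∉ = ∉-S⁺ p₀ λ ()

    e∉ : from (end p₁) ∉ˢ S p₀
    e∉ = ∉-S⁺ p₀ λ ()

    hub-end₀ : ∀ {u} → Chosen p₀ u → Adjacent (hub j) u → u ≢ leaf j → u ≡ end p₀
    hub-end₀ _    hub-leaf ≢leaf = contradiction refl ≢leaf
    hub-end₀ refl hub-end  _     = refl

    end-end₀ : ∀ {u} → Chosen p₀ u → Adjacent (end p₁) u → u ≡ end p₀
    end-end₀ refl (end-end _) = refl

    absurd : ∀ {g} → ¬ Saturates (spider -ₑ e) (S p₀) g
    absurd {g} sat = contradiction (from-injective (to-inj sat h∉ e∉ (to-injective (trans to-gh (sym to-ge))))) λ ()
      where
      to-gh : to (g (from (hub j))) ≡ end p₀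
      to-gh = let h~ , ≢₁ , ≢₂ = to-adj sat h∉ in
        hub-end₀ (∈-S⁻ p₀ (to-∈ sat h∉)) (subst (λ u → Adjacent u (to (g (from (hub j))))) (to-from (hub j)) h~)
          λ eq → Sum.[ ≢₁ ∘ sym , ≢₂ ∘ sym ]
            (subst (Links e (from (hub j))) (trans (cong from (sym eq)) (from-to (g (from (hub j))))) l)

      to-ge : to (g (from (end p₁))) ≡ end p₀
      to-ge = end-end₀ (∈-S⁻ p₀ (to-∈ sat e∉))
        (subst (λ u → Adjacent u (to (g (from (end p₁))))) (to-from (end p₁)) (proj₁ (to-adj sat e∉)))

  -- The general bound gives one direction; the edges between leaves and their hubs, all critical
  -- and distinct, give the other.
  coreCriticalCount-spider : coreCriticalCount spider ≡ x
  coreCriticalCount-spider = ℕ.≤-antisym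
    (ℕ.+-cancelʳ-≤ i _ _ (subst₂ ℕ._≤_ (cong (coreCriticalCount spider ℕ.+_) ε-spider)
      (trans ξ-spider (ℕ.+-comm i x)) (coreCriticalCount+ε≤ξ spider konigEgervary)))
    (subst (ℕ._≤ coreCriticalCount spider) (length-tabulate id)
      (length-≤ (λ j e → Links e (from (hub j)) (from (leaf j))) (Unique.allFin⁺ x) total leftUnique))
    where
    total : Total (λ j e → Links e (from (hub j)) (from (leaf j))) (allFin x)
                  (filter (muCritical? spider) (edgesBetween spider (core spider) (N spider (core spider))))
    total {j} _ =
      let e , e∈ , l = ~⇒link spider (~-from (hub-leaf {j}))
      in e , ∈-filter⁺ (muCritical? spider)
               (∈-edgesBetween⁺ spider (core spider) (N spider (core spider)) e∈ l (leaf∈core j)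
                 (∈-N⁺ spider (leaf∈core j) (~-from leaf-hub)))
               (leaf-edge-critical l) , l

    leftUnique : LeftUnique (λ j e → Links e (from (hub j)) (from (leaf j))) (allFin x)
    leftUnique _ _ l l′ with links-ends l l′
    ... | inj₁ (eq , _) = sym (inj₁-injective (inj₂-injective (from-injective eq)))
    ... | inj₂ (eq , _) = case from-injective eq of λ ()

∃-attaining : ∀ {e x} → e ℕ.≤ x → ∃₂ λ k (H : Graph k) →
              KonigEgervary H × ξ H ≡ x × ε H ≡ e × coreCriticalCount H ≡ x ℕ.∸ e
-- The `e` isolated vertices form the kernel, and the `x ℕ.∸ e` leaves supply the rest of the core.
∃-attaining {e} {x} e≤x =
  size , spider , konigEgervary , trans ξ-spider (ℕ.m+[n∸m]≡n e≤x) , ε-spider , coreCriticalCount-spider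
  where open Spider e (x ℕ.∸ e)

-- From natural numbers to integer differences

≤-difference : ∀ {c e x} → c ℕ.+ e ℕ.≤ x → + c ≤ + x - + e
≤-difference {c} {e} {x} le = subst (_≤ + x - + e) (ℤ.+-identityʳ (+ c))
  (difference-≤⁺ {c} {0} {x} {e} (subst (c ℕ.+ e ℕ.≤_) (sym (ℕ.+-identityʳ x)) le))

∸⇒difference : ∀ {c e x} → e ℕ.≤ x → c ≡ x ℕ.∸ e → + c ≡ + x - + e
∸⇒difference {e = e} {x} e≤x refl = trans (cancel (+ (x ℕ.∸ e)) (+ e)) (cong (λ k → + k - + e) (ℕ.m∸n+n≡m e≤x))
  where
  cancel : ∀ i j → i ≡ (i + j) - j
  cancel = solve-∀

difference+≤ : ∀ {m ϱ c e x} → m ℕ.≤ ϱ ℕ.+ c → c ℕ.+ e ℕ.≤ x → + m - + x + + e ≤ + ϱ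
difference+≤ {m} {ϱ} {c} {e} {x} m≤ c≤ = subst (+ m - + x + + e ≤_) (cancel (+ ϱ) (+ e))
  (ℤ.+-monoˡ-≤ (+ e) (difference-≤⁺ {m} {x} {ϱ} {e} (begin
    m ℕ.+ e           ≤⟨ ℕ.+-monoˡ-≤ e m≤ ⟩
    ϱ ℕ.+ c ℕ.+ e     ≡⟨ ℕ.+-assoc ϱ c e ⟩
    ϱ ℕ.+ (c ℕ.+ e)   ≤⟨ ℕ.+-monoʳ-≤ ϱ c≤ ⟩
    ϱ ℕ.+ x           ∎)))
  where
  open ℕ.≤-Reasoning
  cancel : ∀ i j → (i - j) + j ≡ i
  cancel = solve-∀

theorem4p8 : (n : ℕ) (G : Graph n) → KonigEgervary G →
    -- (i)
    (∀ e → e ∈ edgesBetween G (ker G) (N G (ker G)) → ¬ MuCritical G e)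
    -- (ii)
  × (∀ e → e ∈ edgesBetween G (core G ─ ker G) (N G (ker G)) → ¬ MuCritical G e)
    -- (iii)
  × (∀ e → e ∈ edgesBetween G (core G) (N G (core G)) → MuCritical G e →
       e ∈ edgesBetween G (core G ─ ker G) (N G (core G) ─ N G (ker G)))
    -- (iv): upper bound, attained by some König–Egerváry graph with the same ξ and ε
  × ((+ coreCriticalCount G ≤ + ξ G - + ε G)
     × Σ ℕ (λ k → Σ (Graph k) (λ H →
         KonigEgervary H × ξ H ≡ ξ G × ε H ≡ ε G
         × + coreCriticalCount H ≡ + ξ G - + ε G)))
    -- (v)
  × (+ ϱₑ G ≥ + m G - + ξ G + + ε G)
theorem4p8 n G ke =
  part-i , part-ii , part-iii , (≤-difference {coreCriticalCount G} {ε G} {ξ G} (coreCriticalCount+ε≤ξ G ke) , attained) ,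
  difference+≤ {m G} {ϱₑ G} {coreCriticalCount G} {ε G} {ξ G} (m≤ϱₑ+coreCriticalCount G ke) (coreCriticalCount+ε≤ξ G ke)
  where
  ∉-N-ker : ∀ {e a b} → e ∈ edges G → MuCritical G e → Links e b a → a ∈ˢ core G → b ∉ˢ N G (ker G)
  ∉-N-ker e∈ crit l a∈ b∈ = let k , k∈ , k~b = ∈-N⁻ G b∈ in
    critical-at-core⇒∉N-ker G ke e∈ crit l a∈ k∈ (Graph.~-sym G k~b)

  part-i : ∀ e → e ∈ edgesBetween G (ker G) (N G (ker G)) → ¬ MuCritical G e
  part-i e p crit = let e∈ , a , b , l , a∈ , b∈ = ∈-edgesBetween⁻ G (ker G) (N G (ker G)) p in
    ∉-N-ker e∈ crit l (ker⊆core G ke a∈) b∈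

  part-ii : ∀ e → e ∈ edgesBetween G (core G ─ ker G) (N G (ker G)) → ¬ MuCritical G e
  part-ii e p crit = let e∈ , a , b , l , a∈ , b∈ = ∈-edgesBetween⁻ G (core G ─ ker G) (N G (ker G)) p in
    ∉-N-ker e∈ crit l (Subset.p─q⊆p (core G) (ker G) a∈) b∈

  part-iii : ∀ e → e ∈ edgesBetween G (core G) (N G (core G)) → MuCritical G e →
             e ∈ edgesBetween G (core G ─ ker G) (N G (core G) ─ N G (ker G))
  part-iii e p crit = let e∈ , a , b , l , a∈ , b∈ = ∈-edgesBetween⁻ G (core G) (N G (core G)) p in
    ∈-edgesBetween⁺ G (core G ─ ker G) (N G (core G) ─ N G (ker G)) e∈ l
      (Subset.x∈p∧x∉q⇒x∈p─q a∈ (critical-at-core⇒∉ker G ke e∈ crit l a∈))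
      (Subset.x∈p∧x∉q⇒x∈p─q b∈ (∉-N-ker e∈ crit l a∈))

  attained : Σ ℕ (λ k → Σ (Graph k) (λ H →
    KonigEgervary H × ξ H ≡ ξ G × ε H ≡ ε G × + coreCriticalCount H ≡ + ξ G - + ε G))
  attained =
    let ε≤ξ = Subset.p⊆q⇒∣p∣≤∣q∣ (ker⊆core G ke)
        k , H , keᴴ , ξ≡ , ε≡ , count≡ = ∃-attaining {ε G} {ξ G} ε≤ξ
    in k , H , keᴴ , ξ≡ , ε≡ , ∸⇒difference {coreCriticalCount H} {ε G} {ξ G} ε≤ξ count≡
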